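{- Let $p$ be an odd prime and $m\in\mathbb Z_p$ with $m\not\equiv0,1\pmod p$. Then $$\sum_{k=0}^{p-1}\frac{a_k}{m^k}\equiv\begin{cases}\displaystyle\sum_{k=0}^{p-1}\frac{\binom{2k}k\binom{3k}k}{((m-3)^3/(m-1))^k}\pmod p&\text{if }m\not\equiv3\pmod p,\\ \displaystyle\sum_{k=0}^{p-1}\frac{\binom{2k}k\binom{3k}k}{((m+3)^3/(m-1)^2)^k}\pmod p&\text{if }m\not\equiv-3\pmod p,\end{cases}$$ and $$\sum_{k=0}^{p-1}\frac{Q_k}{(-8m)^k}\equiv\begin{cases}\displaystyle\sum_{k=0}^{p-1}\frac{\binom{2k}k\binom{3k}k}{((4m-3)^3/(m-1))^k}\pmod p&\text{if }m\not\equiv\frac34\pmod p,\\ \displaystyle\sum_{k=0}^{p-1}\frac{\binom{2k}k\binom{3k}k}{(-(2m-3)^3/(m-1)^2)^k}\pmod p&\text{if }m\not\equiv\frac32\pmod p.\end{cases}$$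
   Context: $f_n=\sum_{k=0}^n\binom nk^3$ (Franel numbers), $a_n=\sum_{k=0}^n\binom nk^2\binom{2k}k$, $Q_n=\sum_{k=0}^n\binom nk(-8)^{n-k}f_k$. $\mathbb Z_p$: rationals with denominator prime to $p$; congruences mod $p$ are in $\mathbb Z_p$. -}

module Defs where

open import Data.Nat as ℕ using (ℕ; zero; suc)
open import Data.Nat.Combinatorics using (_C_)
open import Data.Nat.Divisibility using (_∣_)
open import Data.Integer as ℤ using (ℤ; +_)
open import Data.Rational as ℚ using (ℚ; 0ℚ; 1ℚ; ↧ₙ_; _/_; 1/_; ≢-nonZero)
open import Data.Rational.Properties using (_≟_)
open import Data.Product using (Σ-syntax; _×_)
open import Relation.Nullary using (¬_; yes; no)
open import Relation.Binary.PropositionalEquality using (_≡_)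

sumℕ : ℕ → (ℕ → ℕ) → ℕ
sumℕ zero    f = 0
sumℕ (suc n) f = sumℕ n f ℕ.+ f n

sumℤ : ℕ → (ℕ → ℤ) → ℤ
sumℤ zero    f = + 0
sumℤ (suc n) f = sumℤ n f ℤ.+ f n

sumℚ : ℕ → (ℕ → ℚ) → ℚ
sumℚ zero    f = 0ℚ
sumℚ (suc n) f = sumℚ n f ℚ.+ f n

powℚ : ℚ → ℕ → ℚ
powℚ x zero    = 1ℚ
powℚ x (suc k) = x ℚ.* powℚ x k

powℤ : ℤ → ℕ → ℤ
powℤ x zero    = + 1
powℤ x (suc k) = x ℤ.* powℤ x k

ℤ→ℚ : ℤ → ℚ
ℤ→ℚ z = z / 1

ℕ→ℚ : ℕ → ℚ
ℕ→ℚ n = + n / 1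

-- total inverse (only ever applied to nonzero arguments in the theorem)
inv : ℚ → ℚ
inv x with x ≟ 0ℚ
... | yes _ = 0ℚ
... | no x≢0 = 1/_ x {{≢-nonZero x≢0}}

_÷'_ : ℚ → ℚ → ℚ
x ÷' y = x ℚ.* inv y

franel : ℕ → ℕ
franel n = sumℕ (suc n) (λ k → (n C k) ℕ.* (n C k) ℕ.* (n C k))

aSeq : ℕ → ℕ
aSeq n = sumℕ (suc n) (λ k → (n C k) ℕ.* (n C k) ℕ.* ((2 ℕ.* k) C k))

QSeq : ℕ → ℤ
QSeq n = sumℤ (suc n) (λ k → (+ (n C k)) ℤ.* powℤ (ℤ.- (+ 8)) (n ℕ.∸ k) ℤ.* (+ franel k))

InZp : ℕ → ℚ → Set
InZp p x = ¬ (p ∣ ↧ₙ x)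

CongZp : ℕ → ℚ → ℚ → Set
CongZp p x y = Σ[ z ∈ ℚ ] (InZp p z × (x ℚ.- y ≡ ℕ→ℚ p ℚ.* z))

c23 : ℕ → ℚ
c23 k = ℕ→ℚ (((2 ℕ.* k) C k) ℕ.* ((3 ℕ.* k) C k))

S23 : ℕ → ℚ → ℚ
S23 p t = sumℚ p (λ k → c23 k ÷' powℚ t k)

{-# OPTIONS --safe #-}
module Submission where

-- Let F(x) = Σ_{k<p} f_k xᵏ.  Modulo p, Σ_{n<p} C(n,k) xⁿ ≡ xᵏ(1−x)^{p−1−k}, so binomial transforms
-- become substitutions: by Barrucand's identity a_n = Σ C(n,k) f_k the sum of a_k/mᵏ is F(1/(m−1)), and
-- the sum of Q_k/(−8m)ᵏ is F(−1/(8(m−1))).  In the same way MacMahon's identity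
-- f_n = Σ_j C(n+j,3j) c_j 2^{n−2j}, with c_j = C(2j,j) C(3j,j), gives F(x) ≡ Σ_j c_j (x²/(1−2x)³)ʲ; the terms
-- with 3j ≥ p vanish since p divides c_j.  This proves the first case of each congruence.  For the second
-- case, Franel's recurrence is invariant modulo p under f_n ↦ (−8)ⁿ f_{p−1−n}, whence
-- F(x) ≡ F(−1/(8x)).
open import Defs
import Data.Integer as ℤ
import Data.Integer.Properties as ℤ
open import Data.Nat as ℕ using (zero; suc; _≤_; _<_; z≤n; s≤s; _!)
import Data.Nat.Properties as ℕ
import Data.Nat.Divisibility as ℕ
open import Data.Nat.Combinatorics using (_C_; nCk≡n!/k![n-k]!; k>n⇒nCk≡0; k![n∸k]!∣n!; nCk+nC[k+1]≡[n+1]C[k+1]; nCn≡1; nCk≡nC[n∸k]; nC1≡n)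
open import Data.Nat.DivMod using (m/n*n≡m)
open import Data.Nat.Primality using (euclidsLemma; prime⇒nonZero; prime⇒nonTrivial; ¬prime[1])
import Data.Nat.Tactic.RingSolver as ℕSolver
open import Data.Integer.Tactic.RingSolver using (solve-∀)
open import Data.Integer.Divisibility.Signed using (_∣_; divides; ∣⇒∣ᵤ; ∣ᵤ⇒∣; ∣m∣n⇒∣m+n; ∣m⇒∣-m; ∣n⇒∣m*n; ∣m⇒∣m*n)
import Data.Rational as ℚ
import Data.Rational.Properties as ℚ
import Data.Rational.Unnormalised as ℚᵘ
import Data.Rational.Unnormalised.Properties as ℚᵘ
open import Data.Rational.Solver using (module +-*-Solver)
open import Data.Empty using (⊥-elim; ⊥-elim-irr)
open import Data.Product using (_,_)
open import Data.Sum using (inj₁; inj₂)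
open import Relation.Binary.Bundles using (Setoid)
open import Relation.Binary.Definitions using (tri<; tri≈; tri>)
open import Relation.Binary.PropositionalEquality using (_≡_; refl; sym; trans; cong; cong₂; subst; module ≡-Reasoning)
import Relation.Binary.Reasoning.Setoid as SetoidReasoning
open import Relation.Nullary using (yes; no)

open import Data.Nat using (ℕ; _∸_)
open import Data.Nat.Primality using (Prime)
open import Data.Integer using (+_; -_)
open import Data.Rational using (ℚ; 0ℚ; 1ℚ)
open import Data.Product using (_×_)
open import Relation.Nullary using (¬_)
open import Relation.Binary.PropositionalEquality using (_≢_)

-- One congruence drives the modular part: for `i < p`, C(e+i,i) ≡ (-1)ⁱ C(p-1-e,i). It makes a
-- truncated series for (1-y)^(-e-1) equal to the polynomial (1-y)^(p-1-e), and Fermat's theorem,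
-- itself a consequence, rewrites that as a power of the inverse of 1-y. The harder point is the
-- second case, where f_k is compared with f_{p-1-k}: the formulas for f_k do not show this
-- symmetry, but the recurrence does. Its middle coefficient 7n²+7n+2 is unchanged by n ↦ -1-n,
-- while the outer ones, (n+1)² and -8n², trade places up to the factor -8. Modulo p it determines
-- f_{n+1} as long as n+1 < p, because (n+1)² is then a unit, so only f_0 and f_1 have to be
-- matched. The recurrence is proved by creative telescoping on MacMahon's sum, with certificate
-- -3(3n+1)(n-2j). Modulo p no division occurs: an inverse of a is an integer w with w·a ≡ 1, and
-- rationals are replaced by integer residues.

module FranelNumbers where
  open import Data.Integer using (ℤ; _+_; _-_; _*_)
  open ≡-Reasoning

  -- Finite sums of integers

  sum-cong< : ∀ n {f g : ℕ → ℤ} → (∀ k → k < n → f k ≡ g k) → sumℤ n f ≡ sumℤ n g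
  sum-cong< zero    f≡g = refl
  sum-cong< (suc n) f≡g =
    cong₂ _+_ (sum-cong< n λ k k<n → f≡g k (ℕ.m<n⇒m<1+n k<n)) (f≡g n (ℕ.n<1+n n))

  sum-cong : ∀ n {f g : ℕ → ℤ} → (∀ k → f k ≡ g k) → sumℤ n f ≡ sumℤ n g
  sum-cong n f≡g = sum-cong< n λ k _ → f≡g k

  sum-0 : ∀ n {f : ℕ → ℤ} → (∀ k → k < n → f k ≡ + 0) → sumℤ n f ≡ + 0
  sum-0 zero    f≡0 = refl
  sum-0 (suc n) f≡0 =
    cong₂ _+_ (sum-0 n λ k k<n → f≡0 k (ℕ.m<n⇒m<1+n k<n)) (f≡0 n (ℕ.n<1+n n))

  sum-+ : ∀ n (f g : ℕ → ℤ) → sumℤ n (λ k → f k + g k) ≡ sumℤ n f + sumℤ n g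
  sum-+ zero    f g = refl
  sum-+ (suc n) f g = trans (cong (_+ (f n + g n)) (sum-+ n f g)) (interchange (sumℤ n f) (sumℤ n g) (f n) (g n))
    where
    interchange : ∀ a b c d → a + b + (c + d) ≡ a + c + (b + d)
    interchange = solve-∀

  *-sum : ∀ n c (f : ℕ → ℤ) → c * sumℤ n f ≡ sumℤ n (λ k → c * f k)
  *-sum zero    c f = ℤ.*-zeroʳ c
  *-sum (suc n) c f =
    trans (ℤ.*-distribˡ-+ c (sumℤ n f) (f n)) (cong (_+ c * f n) (*-sum n c f))

  sum-* : ∀ n c (f : ℕ → ℤ) → sumℤ n f * c ≡ sumℤ n (λ k → f k * c)
  sum-* n c f =
    trans (ℤ.*-comm (sumℤ n f) c) (trans (*-sum n c f) (sum-cong n λ k → ℤ.*-comm c (f k)))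

  sum-swap : ∀ m n (f : ℕ → ℕ → ℤ) →
    sumℤ m (λ i → sumℤ n (λ j → f i j)) ≡ sumℤ n (λ j → sumℤ m (λ i → f i j))
  sum-swap zero    n f = sym (sum-0 n λ _ _ → refl)
  sum-swap (suc m) n f =
    trans (cong (_+ sumℤ n (f m)) (sum-swap m n f)) (sym (sum-+ n _ (f m)))

  sum-split : ∀ m n (f : ℕ → ℤ) → sumℤ (m ℕ.+ n) f ≡ sumℤ m f + sumℤ n (λ i → f (m ℕ.+ i))
  sum-split m zero    f rewrite ℕ.+-identityʳ m = sym (ℤ.+-identityʳ _)
  sum-split m (suc n) f rewrite ℕ.+-suc m n =
    trans (cong (_+ f (m ℕ.+ n)) (sum-split m n f)) (ℤ.+-assoc (sumℤ m f) _ _)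

  sum-head : ∀ n (f : ℕ → ℤ) → sumℤ (suc n) f ≡ f 0 + sumℤ n (λ i → f (suc i))
  sum-head n f = trans (sum-split 1 n f) (cong (_+ sumℤ n (λ i → f (suc i))) (ℤ.+-identityˡ (f 0)))

  sum-skip : ∀ m n (f : ℕ → ℤ) → (∀ k → k < m → f k ≡ + 0) →
    sumℤ (m ℕ.+ n) f ≡ sumℤ n (λ i → f (m ℕ.+ i))
  sum-skip m n f f≡0 =
    trans (sum-split m n f)
          (trans (cong (_+ sumℤ n (λ i → f (m ℕ.+ i))) (sum-0 m f≡0)) (ℤ.+-identityˡ _))

  sum-truncate : ∀ m n (f : ℕ → ℤ) → m ≤ n → (∀ k → m ≤ k → f k ≡ + 0) → sumℤ n f ≡ sumℤ m f
  sum-truncate m n f m≤n f≡0 = begin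
    sumℤ n f                                       ≡⟨ cong (λ l → sumℤ l f) (ℕ.m+[n∸m]≡n m≤n) ⟨
    sumℤ (m ℕ.+ (n ∸ m)) f                         ≡⟨ sum-split m (n ∸ m) f ⟩
    sumℤ m f + sumℤ (n ∸ m) (λ i → f (m ℕ.+ i))
      ≡⟨ cong (λ z → sumℤ m f + z) (sum-0 (n ∸ m) λ k _ → f≡0 (m ℕ.+ k) (ℕ.m≤m+n m k)) ⟩
    sumℤ m f + + 0                                 ≡⟨ ℤ.+-identityʳ _ ⟩
    sumℤ m f                                       ∎

  sum-reverse : ∀ n (f : ℕ → ℤ) → sumℤ n f ≡ sumℤ n (λ k → f (n ∸ suc k))
  sum-reverse zero    f = refl
  sum-reverse (suc n) f = begin
    sumℤ n f + f n                            ≡⟨ cong (_+ f n) (sum-reverse n f) ⟩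
    sumℤ n (λ k → f (n ∸ suc k)) + f n        ≡⟨ ℤ.+-comm _ (f n) ⟩
    f n + sumℤ n (λ k → f (n ∸ suc k))        ≡⟨ sum-head n (λ k → f (n ∸ k)) ⟨
    sumℤ (suc n) (λ k → f (n ∸ k))            ∎

  pos-sum : ∀ n f → + sumℕ n f ≡ sumℤ n (λ k → + f k)
  pos-sum zero    f = refl
  pos-sum (suc n) f = trans (ℤ.pos-+ (sumℕ n f) (f n)) (cong (λ z → z + + f n) (pos-sum n f))

  -- Binomial coefficients: trinomial revision and Vandermonde's identity

  C-factorial : ∀ a b → ((a ℕ.+ b) C a) ℕ.* (a ! ℕ.* b !) ≡ (a ℕ.+ b) !
  C-factorial a b = begin
    ((a ℕ.+ b) C a) ℕ.* (a ! ℕ.* b !)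
      ≡⟨ cong (λ m → ((a ℕ.+ b) C a) ℕ.* (a ! ℕ.* m !)) (ℕ.m+n∸m≡n a b) ⟨
    ((a ℕ.+ b) C a) ℕ.* (a ! ℕ.* (a ℕ.+ b ∸ a) !)
      ≡⟨ cong (ℕ._* (a ! ℕ.* (a ℕ.+ b ∸ a) !)) (nCk≡n!/k![n-k]! (ℕ.m≤m+n a b)) ⟩
    _
      ≡⟨ m/n*n≡m {{a ℕ.!* (a ℕ.+ b ∸ a) !≢0}} (k![n∸k]!∣n! (ℕ.m≤m+n a b)) ⟩
    (a ℕ.+ b) ! ∎

  -- With n = i+t+r both sides become n! after multiplication by i! t! r!. If i+t > n, both sides
  -- vanish.
  C-trinomial : ∀ n i t → (n C (i ℕ.+ t)) ℕ.* ((i ℕ.+ t) C i) ≡ (n C i) ℕ.* ((n ∸ i) C t)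
  C-trinomial n i t with i ℕ.+ t ℕ.≤? n
  ... | yes le = subst P (ℕ.m+[n∸m]≡n le) (eq (n ∸ (i ℕ.+ t)))
    where
    P : ℕ → Set
    P n = (n C (i ℕ.+ t)) ℕ.* ((i ℕ.+ t) C i) ≡ (n C i) ℕ.* ((n ∸ i) C t)

    left : ∀ x y a b c → x ℕ.* y ℕ.* (a ℕ.* (b ℕ.* c)) ≡ x ℕ.* (y ℕ.* (a ℕ.* b) ℕ.* c)
    left = ℕSolver.solve-∀

    right : ∀ x y a b c → x ℕ.* (a ℕ.* (y ℕ.* (b ℕ.* c))) ≡ x ℕ.* y ℕ.* (a ℕ.* (b ℕ.* c))
    right = ℕSolver.solve-∀

    eq : ∀ r → P (i ℕ.+ t ℕ.+ r)
    eq r = ℕ.*-cancelʳ-≡ _ _ (i ! ℕ.* (t ! ℕ.* r !)) {{nz}} (begin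
      (N C (i ℕ.+ t)) ℕ.* ((i ℕ.+ t) C i) ℕ.* (i ! ℕ.* (t ! ℕ.* r !))
        ≡⟨ left (N C (i ℕ.+ t)) ((i ℕ.+ t) C i) (i !) (t !) (r !) ⟩
      (N C (i ℕ.+ t)) ℕ.* (((i ℕ.+ t) C i) ℕ.* (i ! ℕ.* t !) ℕ.* r !)
        ≡⟨ cong (λ z → (N C (i ℕ.+ t)) ℕ.* (z ℕ.* r !)) (C-factorial i t) ⟩
      (N C (i ℕ.+ t)) ℕ.* ((i ℕ.+ t) ! ℕ.* r !)
        ≡⟨ C-factorial (i ℕ.+ t) r ⟩
      N !
        ≡⟨ cong _! (ℕ.+-assoc i t r) ⟩
      (i ℕ.+ (t ℕ.+ r)) !
        ≡⟨ C-factorial i (t ℕ.+ r) ⟨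
      ((i ℕ.+ (t ℕ.+ r)) C i) ℕ.* (i ! ℕ.* (t ℕ.+ r) !)
        ≡⟨ cong₂ (λ m z → (m C i) ℕ.* (i ! ℕ.* z)) (ℕ.+-assoc i t r) (C-factorial t r) ⟨
      (N C i) ℕ.* (i ! ℕ.* (((t ℕ.+ r) C t) ℕ.* (t ! ℕ.* r !)))
        ≡⟨ right (N C i) ((t ℕ.+ r) C t) (i !) (t !) (r !) ⟩
      (N C i) ℕ.* ((t ℕ.+ r) C t) ℕ.* (i ! ℕ.* (t ! ℕ.* r !))
        ≡⟨ cong (λ m → (N C i) ℕ.* (m C t) ℕ.* (i ! ℕ.* (t ! ℕ.* r !)))
                (trans (cong (_∸ i) (ℕ.+-assoc i t r)) (ℕ.m+n∸m≡n i (t ℕ.+ r))) ⟨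
      (N C i) ℕ.* ((N ∸ i) C t) ℕ.* (i ! ℕ.* (t ! ℕ.* r !)) ∎)
      where
      N = i ℕ.+ t ℕ.+ r
      nz = ℕ.m*n≢0 (i !) (t ! ℕ.* r !) {{i ℕ.!≢0}} {{t ℕ.!* r !≢0}}
  ... | no gt = trans (cong (ℕ._* ((i ℕ.+ t) C i)) (k>n⇒nCk≡0 n<i+t)) (sym rhs≡0)
    where
    n<i+t = ℕ.≰⇒> gt
    rhs≡0 : (n C i) ℕ.* ((n ∸ i) C t) ≡ 0
    rhs≡0 with i ℕ.≤? n
    ... | no i≰n = cong (ℕ._* ((n ∸ i) C t)) (k>n⇒nCk≡0 (ℕ.≰⇒> i≰n))
    ... | yes i≤n = trans (cong ((n C i) ℕ.*_) (k>n⇒nCk≡0 n∸i<t)) (ℕ.*-zeroʳ (n C i))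
      where
      n∸i<t : n ∸ i < t
      n∸i<t = ℕ.+-cancelˡ-< i (n ∸ i) t (subst (ℕ._< i ℕ.+ t) (sym (ℕ.m+[n∸m]≡n i≤n)) n<i+t)

  opaque
    -- Opaque, so that binomial coefficients enter the ring identities as atoms and are handled only
    -- through the laws of this block.
    binom : ℕ → ℕ → ℤ
    binom n k = + (n C k)

    binom-C : ∀ n k → + (n C k) ≡ binom n k
    binom-C n k = refl

    binom-0 : ∀ {n k} → n < k → binom n k ≡ + 0
    binom-0 n<k = cong +_ (k>n⇒nCk≡0 n<k)

    binom-n-0 : ∀ n → binom n 0 ≡ + 1
    binom-n-0 n = cong +_ (trans (nCk≡nC[n∸k] {0} {n} z≤n) (nCn≡1 n))

    pascal : ∀ n k → binom (suc n) (suc k) ≡ binom n k + binom n (suc k)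
    pascal n k = cong +_ (sym (nCk+nC[k+1]≡[n+1]C[k+1] n k))

    binom-sym : ∀ a b → binom (a ℕ.+ b) a ≡ binom (a ℕ.+ b) b
    binom-sym a b = cong +_ (trans (nCk≡nC[n∸k] (ℕ.m≤m+n a b)) (cong ((a ℕ.+ b) C_) (ℕ.m+n∸m≡n a b)))

    trinomial : ∀ n i t → binom n (i ℕ.+ t) * binom (i ℕ.+ t) i ≡ binom n i * binom (n ∸ i) t
    trinomial n i t =
      trans (sym (ℤ.pos-* (n C (i ℕ.+ t)) _)) (trans (cong +_ (C-trinomial n i t)) (ℤ.pos-* (n C i) _))

  -- Both sides choose disjoint sets of sizes i and k among n elements, in either order.
  trinomial-comm : ∀ n i k → binom n i * binom (n ∸ i) k ≡ binom n k * binom (n ∸ k) i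
  trinomial-comm n i k = begin
    binom n i * binom (n ∸ i) k                      ≡⟨ trinomial n i k ⟨
    binom n (i ℕ.+ k) * binom (i ℕ.+ k) i            ≡⟨ cong (binom n (i ℕ.+ k) *_) (binom-sym i k) ⟩
    binom n (i ℕ.+ k) * binom (i ℕ.+ k) k            ≡⟨ cong (λ m → binom n m * binom m k) (ℕ.+-comm i k) ⟩
    binom n (k ℕ.+ i) * binom (k ℕ.+ i) k            ≡⟨ trinomial n k i ⟩
    binom n k * binom (n ∸ k) i                      ∎

  -- C(a,i) stands for C(a,a−i), so that no index is subtracted.
  vandermonde : ∀ a b d N → a < N →
    sumℤ N (λ i → binom a i * binom b (d ℕ.+ i)) ≡ binom (a ℕ.+ b) (a ℕ.+ d)
  vandermonde zero b d (suc N) (s≤s _) = begin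
    sumℤ (suc N) (λ i → binom 0 i * binom b (d ℕ.+ i))
      ≡⟨ sum-head N _ ⟩
    binom 0 0 * binom b (d ℕ.+ 0) + sumℤ N (λ i → binom 0 (suc i) * binom b (d ℕ.+ suc i))
      ≡⟨ cong₂ _+_ (trans (trans (cong (_* binom b (d ℕ.+ 0)) (binom-n-0 0)) (ℤ.*-identityˡ _)) (cong (binom b) (ℕ.+-identityʳ d)))
                   (sum-0 N λ k _ → cong (_* binom b (d ℕ.+ suc k)) (binom-0 (s≤s z≤n))) ⟩
    binom b d + + 0
      ≡⟨ ℤ.+-identityʳ _ ⟩
    binom b d ∎
  vandermonde (suc a) b d (suc N) (s≤s a<N) = begin
    sumℤ (suc N) (λ i → binom (suc a) i * binom b (d ℕ.+ i))
      ≡⟨ sum-head N _ ⟩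
    binom (suc a) 0 * x₀ + sumℤ N (λ i → binom (suc a) (suc i) * binom b (d ℕ.+ suc i))
      ≡⟨ cong₂ (λ z s → z * x₀ + s) (trans (binom-n-0 (suc a)) (sym (binom-n-0 a)))
               (sum-cong N λ i → trans (cong (_* binom b (d ℕ.+ suc i)) (pascal a i))
                                       (ℤ.*-distribʳ-+ (binom b (d ℕ.+ suc i)) (binom a i) (binom a (suc i)))) ⟩
    binom a 0 * x₀ + sumℤ N (λ i → binom a i * binom b (d ℕ.+ suc i) + binom a (suc i) * binom b (d ℕ.+ suc i))
      ≡⟨ cong (λ z → binom a 0 * x₀ + z) (sum-+ N _ _) ⟩
    binom a 0 * x₀ + (sumℤ N (λ i → binom a i * binom b (d ℕ.+ suc i))
                      + sumℤ N (λ i → binom a (suc i) * binom b (d ℕ.+ suc i)))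
      ≡⟨ rearrange (binom a 0 * x₀) (sumℤ N (λ i → binom a i * binom b (d ℕ.+ suc i))) _ ⟩
    sumℤ N (λ i → binom a i * binom b (d ℕ.+ suc i))
      + (binom a 0 * x₀ + sumℤ N (λ i → binom a (suc i) * binom b (d ℕ.+ suc i)))
      ≡⟨ cong₂ _+_ (sum-cong N λ i → cong (λ m → binom a i * binom b m) (ℕ.+-suc d i))
                   (sym (sum-head N (λ i → binom a i * binom b (d ℕ.+ i)))) ⟩
    -- Pascal's rule in the first factor leaves two instances for `a`, one of them with the shift
    -- raised to `suc d`; Pascal's rule on the right-hand side joins them again.
    sumℤ N (λ i → binom a i * binom b (suc d ℕ.+ i)) + sumℤ (suc N) (λ i → binom a i * binom b (d ℕ.+ i))
      ≡⟨ cong₂ _+_ (vandermonde a b (suc d) N a<N) (vandermonde a b d (suc N) (ℕ.m<n⇒m<1+n a<N)) ⟩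
    binom (a ℕ.+ b) (a ℕ.+ suc d) + binom (a ℕ.+ b) (a ℕ.+ d)
      ≡⟨ cong (λ m → binom (a ℕ.+ b) m + binom (a ℕ.+ b) (a ℕ.+ d)) (ℕ.+-suc a d) ⟩
    binom (a ℕ.+ b) (suc (a ℕ.+ d)) + binom (a ℕ.+ b) (a ℕ.+ d)
      ≡⟨ ℤ.+-comm (binom (a ℕ.+ b) (suc (a ℕ.+ d))) (binom (a ℕ.+ b) (a ℕ.+ d)) ⟩
    binom (a ℕ.+ b) (a ℕ.+ d) + binom (a ℕ.+ b) (suc (a ℕ.+ d))
      ≡⟨ pascal (a ℕ.+ b) (a ℕ.+ d) ⟨
    binom (suc a ℕ.+ b) (suc a ℕ.+ d) ∎
    where
    x₀ = binom b (d ℕ.+ 0)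
    rearrange : ∀ x y z → x + (y + z) ≡ y + (x + z)
    rearrange = solve-∀

  -- Franel numbers: the identities of Strehl and Barrucand

  fr : ℕ → ℤ
  fr n = + franel n

  pos-*₃ : ∀ a b c → + (a ℕ.* b ℕ.* c) ≡ + a * + b * + c
  pos-*₃ a b c = trans (ℤ.pos-* (a ℕ.* b) c) (cong (_* + c) (ℤ.pos-* a b))

  franel-cubes : ∀ n → fr n ≡ sumℤ (suc n) (λ k → binom n k * binom n k * binom n k)
  franel-cubes n = trans (pos-sum (suc n) _) (sum-cong (suc n) λ k →
    trans (pos-*₃ (n C k) (n C k) (n C k)) (cong (λ b → b * b * b) (binom-C n k)))

  binom-complement : ∀ {n k} → k ≤ n → binom n (n ∸ k) ≡ binom n k
  binom-complement {n} {k} k≤n = begin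
    binom n (n ∸ k)                  ≡⟨ cong (λ m → binom m (n ∸ k)) (ℕ.m∸n+n≡m k≤n) ⟨
    binom (n ∸ k ℕ.+ k) (n ∸ k)      ≡⟨ binom-sym (n ∸ k) k ⟩
    binom (n ∸ k ℕ.+ k) k            ≡⟨ cong (λ m → binom m k) (ℕ.m∸n+n≡m k≤n) ⟩
    binom n k                        ∎

  vandermonde-diagonal : ∀ {n k} N → k ≤ n → n ∸ k < N →
    sumℤ N (λ i → binom (n ∸ k) i * binom k i) ≡ binom n k
  vandermonde-diagonal {n} {k} N k≤n n∸k<N = begin
    sumℤ N (λ i → binom (n ∸ k) i * binom k i)   ≡⟨ vandermonde (n ∸ k) k 0 N n∸k<N ⟩
    binom (n ∸ k ℕ.+ k) (n ∸ k ℕ.+ 0)            ≡⟨ cong₂ binom (ℕ.m∸n+n≡m k≤n) (ℕ.+-identityʳ (n ∸ k)) ⟩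
    binom n (n ∸ k)                              ≡⟨ binom-complement k≤n ⟩
    binom n k                                    ∎

  sum-skip-≤ : ∀ n m (f : ℕ → ℤ) → m ≤ n → (∀ k → k < m → f k ≡ + 0) →
    sumℤ (suc n) f ≡ sumℤ (suc (n ∸ m)) (λ i → f (m ℕ.+ i))
  sum-skip-≤ n m f m≤n f≡0 =
    trans (cong (λ l → sumℤ l f) (sym (trans (ℕ.+-suc m (n ∸ m)) (cong suc (ℕ.m+[n∸m]≡n m≤n)))))
          (sum-skip m (suc (n ∸ m)) f f≡0)

  *-0ʳ : ∀ x {y} → y ≡ + 0 → x * y ≡ + 0
  *-0ʳ x refl = ℤ.*-zeroʳ x

  *-0ˡ : ∀ {x} y → x ≡ + 0 → x * y ≡ + 0
  *-0ˡ y refl = refl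

  -- One of the three factors C(n,i) is opened by Vandermonde as Σ_l C(n-i,l) C(i,l). Trinomial
  -- revision turns the summand into C(n,l)² C(n-l,i) C(n-l,i-l), and Vandermonde applies once more,
  -- now in i.
  franel-complement : ∀ n →
    fr n ≡ sumℤ (suc n) (λ l → binom n l * binom n l * binom (2 ℕ.* (n ∸ l)) n)
  franel-complement n = begin
    fr n
      ≡⟨ franel-cubes n ⟩
    sumℤ (suc n) (λ i → binom n i * binom n i * binom n i)
      ≡⟨ sum-cong< (suc n) (λ i i<sn → expand i (ℕ.s≤s⁻¹ i<sn)) ⟩
    sumℤ (suc n) (λ i → sumℤ (suc n) (λ l → term i l))
      ≡⟨ sum-swap (suc n) (suc n) term ⟩
    sumℤ (suc n) (λ l → sumℤ (suc n) (λ i → term i l))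
      ≡⟨ sum-cong< (suc n) (λ l l<sn → collect l (ℕ.s≤s⁻¹ l<sn)) ⟩
    sumℤ (suc n) (λ l → binom n l * binom n l * binom (2 ℕ.* (n ∸ l)) n) ∎
    where
    term : ℕ → ℕ → ℤ
    term i l = binom n l * binom (n ∸ l) i * (binom n i * binom i l)

    swap-middle : ∀ a b c → a * a * (b * c) ≡ a * b * (a * c)
    swap-middle = solve-∀

    expand : ∀ i → i ≤ n → binom n i * binom n i * binom n i ≡ sumℤ (suc n) (λ l → term i l)
    expand i i≤n = begin
      binom n i * binom n i * binom n i
        ≡⟨ cong (binom n i * binom n i *_) (vandermonde-diagonal (suc n) i≤n (s≤s (ℕ.m∸n≤m n i))) ⟨
      binom n i * binom n i * sumℤ (suc n) (λ l → binom (n ∸ i) l * binom i l)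
        ≡⟨ *-sum (suc n) (binom n i * binom n i) _ ⟩
      sumℤ (suc n) (λ l → binom n i * binom n i * (binom (n ∸ i) l * binom i l))
        ≡⟨ sum-cong (suc n) (λ l → trans (swap-middle (binom n i) (binom (n ∸ i) l) (binom i l))
                                         (cong (_* (binom n i * binom i l)) (trinomial-comm n i l))) ⟩
      sumℤ (suc n) (λ l → term i l) ∎

    regroup : ∀ a b c → a * b * (a * c) ≡ a * a * (c * b)
    regroup = solve-∀

    collect : ∀ l → l ≤ n →
      sumℤ (suc n) (λ i → term i l) ≡ binom n l * binom n l * binom (2 ℕ.* (n ∸ l)) n
    collect l l≤n = begin
      sumℤ (suc n) (λ i → term i l)
        ≡⟨ sum-skip-≤ n l (λ i → term i l) l≤n
             (λ i i<l → *-0ʳ (binom n l * binom (n ∸ l) i) (*-0ʳ (binom n i) (binom-0 i<l))) ⟩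
      sumℤ (suc m) (λ i → term (l ℕ.+ i) l)
        ≡⟨ sum-cong (suc m) (λ i → trans (cong (binom n l * binom m (l ℕ.+ i) *_) (trinomial n l i))
                                         (regroup (binom n l) (binom m (l ℕ.+ i)) (binom m i))) ⟩
      sumℤ (suc m) (λ i → binom n l * binom n l * (binom m i * binom m (l ℕ.+ i)))
        ≡⟨ *-sum (suc m) (binom n l * binom n l) _ ⟨
      binom n l * binom n l * sumℤ (suc m) (λ i → binom m i * binom m (l ℕ.+ i))
        ≡⟨ cong (binom n l * binom n l *_) (vandermonde m m l (suc m) (ℕ.n<1+n m)) ⟩
      binom n l * binom n l * binom (m ℕ.+ m) (m ℕ.+ l)
        ≡⟨ cong (binom n l * binom n l *_)
                (cong₂ binom (cong (m ℕ.+_) (sym (ℕ.+-identityʳ m))) (ℕ.m∸n+n≡m l≤n)) ⟩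
      binom n l * binom n l * binom (2 ℕ.* m) n ∎
      where m = n ∸ l

  -- Strehl's form, from the previous one by k = n-l. Unlike the sum of cubes, it allows the
  -- transform in `barrucand` to be summed over the Franel index.
  franel-strehl : ∀ n → fr n ≡ sumℤ (suc n) (λ k → binom n k * binom n k * binom (2 ℕ.* k) n)
  franel-strehl n = begin
    fr n
      ≡⟨ franel-complement n ⟩
    sumℤ (suc n) (λ l → binom n l * binom n l * binom (2 ℕ.* (n ∸ l)) n)
      ≡⟨ sum-reverse (suc n) _ ⟩
    sumℤ (suc n) (λ k → binom n (n ∸ k) * binom n (n ∸ k) * binom (2 ℕ.* (n ∸ (n ∸ k))) n)
      ≡⟨ sum-cong< (suc n) (λ k k<sn →
           cong₂ (λ b m → b * b * binom (2 ℕ.* m) n)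
                 (binom-complement (ℕ.s≤s⁻¹ k<sn)) (ℕ.m∸[m∸n]≡n (ℕ.s≤s⁻¹ k<sn))) ⟩
    sumℤ (suc n) (λ k → binom n k * binom n k * binom (2 ℕ.* k) n) ∎

  -- In Strehl's form of f_s, the two factors C(s,k) are absorbed separately: C(n,s) C(s,k) = C(n,k)
  -- C(n-k,s-k) and C(2k,s) C(s,k) = C(2k,k) C(k,s-k). Vandermonde in s-k then supplies the second
  -- C(n,k).
  barrucand : ∀ n → + aSeq n ≡ sumℤ (suc n) (λ k → binom n k * fr k)
  barrucand n = sym (begin
    sumℤ (suc n) (λ s → binom n s * fr s)
      ≡⟨ sum-cong< (suc n) (λ s s<sn → expand s s<sn) ⟩
    sumℤ (suc n) (λ s → sumℤ (suc n) (λ k → term s k))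
      ≡⟨ sum-swap (suc n) (suc n) term ⟩
    sumℤ (suc n) (λ k → sumℤ (suc n) (λ s → term s k))
      ≡⟨ sum-cong< (suc n) (λ k k<sn → collect k (ℕ.s≤s⁻¹ k<sn)) ⟩
    sumℤ (suc n) (λ k → binom n k * binom n k * binom (2 ℕ.* k) k)
      ≡⟨ sum-cong (suc n) (λ k → sym (trans (pos-*₃ (n C k) (n C k) ((2 ℕ.* k) C k))
           (cong₂ (λ b c → b * b * c) (binom-C n k) (binom-C (2 ℕ.* k) k)))) ⟩
    sumℤ (suc n) (λ k → + ((n C k) ℕ.* (n C k) ℕ.* ((2 ℕ.* k) C k)))
      ≡⟨ pos-sum (suc n) _ ⟨
    + aSeq n ∎)
    where
    term : ℕ → ℕ → ℤ
    term s k = binom n s * (binom s k * binom s k * binom (2 ℕ.* k) s)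

    expand : ∀ s → s < suc n → binom n s * fr s ≡ sumℤ (suc n) (λ k → term s k)
    expand s s<sn = begin
      binom n s * fr s
        ≡⟨ cong (binom n s *_) (franel-strehl s) ⟩
      binom n s * sumℤ (suc s) (λ k → binom s k * binom s k * binom (2 ℕ.* k) s)
        ≡⟨ cong (binom n s *_) (sum-truncate (suc s) (suc n) _ s<sn (λ k s<k →
             *-0ˡ (binom (2 ℕ.* k) s) (*-0ˡ (binom s k) (binom-0 s<k)))) ⟨
      binom n s * sumℤ (suc n) (λ k → binom s k * binom s k * binom (2 ℕ.* k) s)
        ≡⟨ *-sum (suc n) (binom n s) _ ⟩
      sumℤ (suc n) (λ k → term s k) ∎

    pair : ∀ a b c → a * (b * b * c) ≡ a * b * (c * b)
    pair = solve-∀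

    regroup : ∀ a b c d → a * b * (c * d) ≡ a * c * (b * d)
    regroup = solve-∀

    final : ∀ a b → a * b * a ≡ a * a * b
    final = solve-∀

    2k∸k : ∀ k → 2 ℕ.* k ∸ k ≡ k
    2k∸k k = trans (ℕ.m+n∸m≡n k (k ℕ.+ 0)) (ℕ.+-identityʳ k)

    collect : ∀ k → k ≤ n →
      sumℤ (suc n) (λ s → term s k) ≡ binom n k * binom n k * binom (2 ℕ.* k) k
    collect k k≤n = begin
      sumℤ (suc n) (λ s → term s k)
        ≡⟨ sum-skip-≤ n k (λ s → term s k) k≤n (λ s s<k →
             *-0ʳ (binom n s) (*-0ˡ (binom (2 ℕ.* k) s) (*-0ˡ (binom s k) (binom-0 s<k)))) ⟩
      sumℤ (suc (n ∸ k)) (λ i → term (k ℕ.+ i) k)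
        ≡⟨ sum-cong (suc (n ∸ k)) (λ i → begin
             term (k ℕ.+ i) k
               ≡⟨ pair (binom n (k ℕ.+ i)) (binom (k ℕ.+ i) k) (binom (2 ℕ.* k) (k ℕ.+ i)) ⟩
             binom n (k ℕ.+ i) * binom (k ℕ.+ i) k * (binom (2 ℕ.* k) (k ℕ.+ i) * binom (k ℕ.+ i) k)
               ≡⟨ cong₂ _*_ (trinomial n k i) (trans (trinomial (2 ℕ.* k) k i)
                    (cong (λ m → binom (2 ℕ.* k) k * binom m i) (2k∸k k))) ⟩
             binom n k * binom (n ∸ k) i * (binom (2 ℕ.* k) k * binom k i)
               ≡⟨ regroup (binom n k) (binom (n ∸ k) i) (binom (2 ℕ.* k) k) (binom k i) ⟩
             binom n k * binom (2 ℕ.* k) k * (binom (n ∸ k) i * binom k i) ∎) ⟩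
      sumℤ (suc (n ∸ k)) (λ i → binom n k * binom (2 ℕ.* k) k * (binom (n ∸ k) i * binom k i))
        ≡⟨ *-sum (suc (n ∸ k)) (binom n k * binom (2 ℕ.* k) k) _ ⟨
      binom n k * binom (2 ℕ.* k) k * sumℤ (suc (n ∸ k)) (λ i → binom (n ∸ k) i * binom k i)
        ≡⟨ cong (binom n k * binom (2 ℕ.* k) k *_)
                (vandermonde-diagonal (suc (n ∸ k)) k≤n (ℕ.n<1+n (n ∸ k))) ⟩
      binom n k * binom (2 ℕ.* k) k * binom n k
        ≡⟨ final (binom n k) (binom (2 ℕ.* k) k) ⟩
      binom n k * binom n k * binom (2 ℕ.* k) k ∎

  -- Pfaff–Saalschütz for ₃F₂(n+1, −k, k−n; 1, 1; 1).
  binom-square : ∀ {n k} → k ≤ n →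
    binom n k * binom n k ≡ sumℤ (suc n) (λ j → binom k j * binom (n ∸ k) j * binom (n ℕ.+ j) j)
  binom-square {n} {k} k≤n = sym (begin
    sumℤ (suc n) (λ j → binom k j * binom (n ∸ k) j * binom (n ℕ.+ j) j)
      ≡⟨ sum-cong< (suc n) expand ⟩
    sumℤ (suc n) (λ j → sumℤ (suc n) (λ i → term j i))
      ≡⟨ sum-swap (suc n) (suc n) term ⟩
    sumℤ (suc n) (λ i → sumℤ (suc n) (λ j → term j i))
      ≡⟨ sum-cong< (suc n) (λ i i<sn → collect i (ℕ.s≤s⁻¹ i<sn)) ⟩
    sumℤ (suc n) (λ i → binom n k * (binom (n ∸ k) i * binom k i))
      ≡⟨ *-sum (suc n) (binom n k) _ ⟨
    binom n k * sumℤ (suc n) (λ i → binom (n ∸ k) i * binom k i)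
      ≡⟨ cong (binom n k *_) (vandermonde-diagonal (suc n) k≤n (s≤s (ℕ.m∸n≤m n k))) ⟩
    binom n k * binom n k ∎)
    where
    term : ℕ → ℕ → ℤ
    term j i = binom n i * (binom k j * binom j i) * binom (n ∸ k) j

    regroup₁ : ∀ a b c d → a * b * (c * d) ≡ d * (a * c) * b
    regroup₁ = solve-∀

    expand : ∀ j → j < suc n →
      binom k j * binom (n ∸ k) j * binom (n ℕ.+ j) j ≡ sumℤ (suc n) (λ i → term j i)
    expand j j<sn = begin
      binom k j * binom (n ∸ k) j * binom (n ℕ.+ j) j
        ≡⟨ cong (binom k j * binom (n ∸ k) j *_)
                (cong₂ binom (ℕ.+-comm n j) (sym (ℕ.+-identityʳ j))) ⟩
      binom k j * binom (n ∸ k) j * binom (j ℕ.+ n) (j ℕ.+ 0)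
        -- C(n+j,j) is opened as Σ_i C(j,i) C(n,i), so that the sum over j for fixed i is again of
        -- Vandermonde type; the remaining sum over i is a further Vandermonde sum.
        ≡⟨ cong (binom k j * binom (n ∸ k) j *_) (vandermonde j n 0 (suc n) j<sn) ⟨
      binom k j * binom (n ∸ k) j * sumℤ (suc n) (λ i → binom j i * binom n i)
        ≡⟨ *-sum (suc n) (binom k j * binom (n ∸ k) j) _ ⟩
      sumℤ (suc n) (λ i → binom k j * binom (n ∸ k) j * (binom j i * binom n i))
        ≡⟨ sum-cong (suc n) (λ i → regroup₁ (binom k j) (binom (n ∸ k) j) (binom j i) (binom n i)) ⟩
      sumℤ (suc n) (λ i → term j i) ∎

    regroup₂ : ∀ a b c d → a * (b * c) * d ≡ a * b * (c * d)
    regroup₂ = solve-∀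

    regroup₃ : ∀ a b c → a * b * c ≡ a * c * b
    regroup₃ = solve-∀

    -- For i > k the truncated `k ∸ i` would give wrong indices, but there the factor C(k,i)
    -- vanishes.
    merge : ∀ i → binom k i * binom (k ∸ i ℕ.+ (n ∸ k)) (k ∸ i ℕ.+ i) ≡ binom k i * binom (n ∸ i) k
    merge i with i ℕ.≤? k
    ... | no i≰k = trans (*-0ˡ _ (binom-0 (ℕ.≰⇒> i≰k))) (sym (*-0ˡ _ (binom-0 (ℕ.≰⇒> i≰k))))
    ... | yes i≤k = cong (binom k i *_) (cong₂ binom
      (trans (sym (ℕ.+-∸-comm (n ∸ k) i≤k)) (cong (_∸ i) (ℕ.m+[n∸m]≡n k≤n))) (ℕ.m∸n+n≡m i≤k))

    collect : ∀ i → i ≤ n →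
      sumℤ (suc n) (λ j → term j i) ≡ binom n k * (binom (n ∸ k) i * binom k i)
    collect i i≤n = begin
      sumℤ (suc n) (λ j → term j i)
        ≡⟨ sum-skip-≤ n i (λ j → term j i) i≤n (λ j j<i →
             *-0ˡ (binom (n ∸ k) j) (*-0ʳ (binom n i) (*-0ʳ (binom k j) (binom-0 j<i)))) ⟩
      sumℤ (suc (n ∸ i)) (λ t → term (i ℕ.+ t) i)
        ≡⟨ sum-cong (suc (n ∸ i)) (λ t →
             trans (cong (λ z → binom n i * z * binom (n ∸ k) (i ℕ.+ t)) (trinomial k i t))
                   (regroup₂ (binom n i) (binom k i) (binom (k ∸ i) t) (binom (n ∸ k) (i ℕ.+ t)))) ⟩
      sumℤ (suc (n ∸ i)) (λ t → binom n i * binom k i * (binom (k ∸ i) t * binom (n ∸ k) (i ℕ.+ t)))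
        ≡⟨ *-sum (suc (n ∸ i)) (binom n i * binom k i) _ ⟨
      binom n i * binom k i * sumℤ (suc (n ∸ i)) (λ t → binom (k ∸ i) t * binom (n ∸ k) (i ℕ.+ t))
        ≡⟨ cong (binom n i * binom k i *_)
                (vandermonde (k ∸ i) (n ∸ k) i (suc (n ∸ i)) (s≤s (ℕ.∸-monoˡ-≤ i k≤n))) ⟩
      binom n i * binom k i * binom (k ∸ i ℕ.+ (n ∸ k)) (k ∸ i ℕ.+ i)
        ≡⟨ trans (ℤ.*-assoc (binom n i) (binom k i) _)
                 (trans (cong (binom n i *_) (merge i)) (sym (ℤ.*-assoc (binom n i) (binom k i) _))) ⟩
      binom n i * binom k i * binom (n ∸ i) k
        ≡⟨ regroup₃ (binom n i) (binom k i) (binom (n ∸ i) k) ⟩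
      binom n i * binom (n ∸ i) k * binom k i
        ≡⟨ cong (_* binom k i) (trinomial-comm n i k) ⟩
      binom n k * binom (n ∸ k) i * binom k i
        ≡⟨ ℤ.*-assoc (binom n k) (binom (n ∸ k) i) (binom k i) ⟩
      binom n k * (binom (n ∸ k) i * binom k i) ∎

  -- The binomial theorem and MacMahon's identity

  binomial-theorem : ∀ r y N → r < N → sumℤ N (λ i → binom r i * powℤ y i) ≡ powℤ (+ 1 + y) r
  binomial-theorem zero y (suc N) _ = begin
    sumℤ (suc N) (λ i → binom 0 i * powℤ y i)
      ≡⟨ sum-head N _ ⟩
    binom 0 0 * + 1 + sumℤ N (λ i → binom 0 (suc i) * powℤ y (suc i))
      ≡⟨ cong₂ _+_ (cong (_* + 1) (binom-n-0 0))
                   (sum-0 N λ i _ → *-0ˡ (powℤ y (suc i)) (binom-0 (s≤s z≤n))) ⟩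
    + 1 ∎
  binomial-theorem (suc r) y (suc N) (s≤s r<N) = begin
    sumℤ (suc N) (λ i → binom (suc r) i * powℤ y i)
      ≡⟨ sum-head N _ ⟩
    binom (suc r) 0 * + 1 + sumℤ N (λ i → binom (suc r) (suc i) * powℤ y (suc i))
      ≡⟨ cong₂ (λ b s → b * + 1 + s) (trans (binom-n-0 (suc r)) (sym (binom-n-0 r)))
           (trans (sum-cong N (λ i → trans (cong (_* powℤ y (suc i)) (pascal r i))
                    (distribute (binom r i) (binom r (suc i)) y (powℤ y i))))
                  (sum-+ N (λ i → y * (binom r i * powℤ y i)) (λ i → binom r (suc i) * powℤ y (suc i)))) ⟩
    binom r 0 * + 1 + (sumℤ N (λ i → y * (binom r i * powℤ y i))
                       + sumℤ N (λ i → binom r (suc i) * powℤ y (suc i)))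
      ≡⟨ rearrange (binom r 0 * + 1) (sumℤ N (λ i → y * (binom r i * powℤ y i))) _ ⟩
    (binom r 0 * + 1 + sumℤ N (λ i → binom r (suc i) * powℤ y (suc i)))
      + sumℤ N (λ i → y * (binom r i * powℤ y i))
      ≡⟨ cong₂ _+_ (sym (sum-head N (λ i → binom r i * powℤ y i))) (sym (*-sum N y _)) ⟩
    sumℤ (suc N) (λ i → binom r i * powℤ y i) + y * sumℤ N (λ i → binom r i * powℤ y i)
      ≡⟨ cong₂ (λ s t → s + y * t) (binomial-theorem r y (suc N) (ℕ.m<n⇒m<1+n r<N))
                                   (binomial-theorem r y N r<N) ⟩
    powℤ (+ 1 + y) r + y * powℤ (+ 1 + y) r
      ≡⟨ factor y (powℤ (+ 1 + y) r) ⟩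
    powℤ (+ 1 + y) (suc r) ∎
    where
    distribute : ∀ a b y p → (a + b) * (y * p) ≡ y * (a * p) + b * (y * p)
    distribute = solve-∀
    rearrange : ∀ x y z → x + (y + z) ≡ x + z + y
    rearrange = solve-∀
    factor : ∀ y p → p + y * p ≡ (+ 1 + y) * p
    factor = solve-∀

  powℤ-1 : ∀ k → powℤ (+ 1) k ≡ + 1
  powℤ-1 zero    = refl
  powℤ-1 (suc k) = trans (ℤ.*-identityˡ _) (powℤ-1 k)

  row-sum : ∀ r N → r < N → sumℤ N (binom r) ≡ powℤ (+ 2) r
  row-sum r N r<N = trans
    (sum-cong N λ i → sym (trans (cong (binom r i *_) (powℤ-1 i)) (ℤ.*-identityʳ (binom r i))))
    (binomial-theorem r (+ 1) N r<N)

  -- c j = (3j)!/j!³ and u n j = (n+j)!/((n−2j)! j!³).  Since u n j = 0 for n < 2j, the truncated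
  -- exponents n ∸ 2j that accompany it are harmless.
  c : ℕ → ℤ
  c j = binom (2 ℕ.* j) j * binom (3 ℕ.* j) j

  u : ℕ → ℕ → ℤ
  u n j = binom (n ℕ.+ j) (3 ℕ.* j) * c j

  -- Both sides are (n+j)!/((n-2j)! j!³). Working by trinomial revision instead of factorials also
  -- covers n < 2j, where both sides are 0.
  u-multinomial : ∀ n j → binom n j * binom (n ∸ j) j * binom (n ℕ.+ j) j ≡ u n j
  u-multinomial n j = begin
    binom n j * binom (n ∸ j) j * binom (n ℕ.+ j) j
      ≡⟨ regroup (binom n j) (binom (n ∸ j) j) (binom (n ℕ.+ j) j) ⟩
    binom (n ℕ.+ j) j * binom n j * binom (n ∸ j) j
      ≡⟨ cong (λ m → binom (n ℕ.+ j) j * binom m j * binom (n ∸ j) j) (ℕ.m+n∸n≡m n j) ⟨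
    binom (n ℕ.+ j) j * binom (n ℕ.+ j ∸ j) j * binom (n ∸ j) j
      ≡⟨ cong (_* binom (n ∸ j) j) (trinomial (n ℕ.+ j) j j) ⟨
    binom (n ℕ.+ j) (j ℕ.+ j) * binom (j ℕ.+ j) j * binom (n ∸ j) j
      ≡⟨ cong₂ (λ l m → binom (n ℕ.+ j) (j ℕ.+ j) * binom l j * binom m j) (ℕ-double j) (trans (sym (ℕ.∸-+-assoc (n ℕ.+ j) j j)) (cong (_∸ j) (ℕ.m+n∸n≡m n j))) ⟨
    binom (n ℕ.+ j) (j ℕ.+ j) * binom (2 ℕ.* j) j * binom (n ℕ.+ j ∸ (j ℕ.+ j)) j
      ≡⟨ regroup₂ (binom (n ℕ.+ j) (j ℕ.+ j)) (binom (2 ℕ.* j) j) (binom (n ℕ.+ j ∸ (j ℕ.+ j)) j) ⟩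
    binom (n ℕ.+ j) (j ℕ.+ j) * binom (n ℕ.+ j ∸ (j ℕ.+ j)) j * binom (2 ℕ.* j) j
      ≡⟨ cong (_* binom (2 ℕ.* j) j) (trinomial (n ℕ.+ j) (j ℕ.+ j) j) ⟨
    binom (n ℕ.+ j) (j ℕ.+ j ℕ.+ j) * binom (j ℕ.+ j ℕ.+ j) (j ℕ.+ j) * binom (2 ℕ.* j) j
      ≡⟨ cong (λ b → binom (n ℕ.+ j) (j ℕ.+ j ℕ.+ j) * b * binom (2 ℕ.* j) j) (binom-sym (j ℕ.+ j) j) ⟩
    binom (n ℕ.+ j) (j ℕ.+ j ℕ.+ j) * binom (j ℕ.+ j ℕ.+ j) j * binom (2 ℕ.* j) j
      ≡⟨ cong (λ l → binom (n ℕ.+ j) l * binom l j * binom (2 ℕ.* j) j) (ℕ-triple j) ⟨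
    binom (n ℕ.+ j) (3 ℕ.* j) * binom (3 ℕ.* j) j * binom (2 ℕ.* j) j
      ≡⟨ regroup₃ (binom (n ℕ.+ j) (3 ℕ.* j)) (binom (3 ℕ.* j) j) (binom (2 ℕ.* j) j) ⟩
    u n j ∎
    where
    regroup : ∀ a b c → a * b * c ≡ c * a * b
    regroup = solve-∀
    regroup₂ : ∀ a b c → a * b * c ≡ a * c * b
    regroup₂ = solve-∀
    regroup₃ : ∀ a b c → a * b * c ≡ a * (c * b)
    regroup₃ = solve-∀
    ℕ-double : ∀ j → 2 ℕ.* j ≡ j ℕ.+ j
    ℕ-double = ℕSolver.solve-∀
    ℕ-triple : ∀ j → 3 ℕ.* j ≡ j ℕ.+ j ℕ.+ j
    ℕ-triple = ℕSolver.solve-∀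

  -- Two of the three factors C(n,k) are expanded by `binom-square`. After C(n,k) C(n-k,j) = C(n,j)
  -- C(n-j,k) and C(n-j,k) C(k,j) = C(n-j,j) C(n-2j,k-j), the sum over k is a complete row of
  -- Pascal's triangle, which gives 2^(n-2j).
  macmahon : ∀ n → fr n ≡ sumℤ (suc n) (λ j → u n j * powℤ (+ 2) (n ∸ 2 ℕ.* j))
  macmahon n = begin
    fr n
      ≡⟨ franel-cubes n ⟩
    sumℤ (suc n) (λ k → binom n k * binom n k * binom n k)
      ≡⟨ sum-cong< (suc n) (λ k k<sn → expand k (ℕ.s≤s⁻¹ k<sn)) ⟩
    sumℤ (suc n) (λ k → sumℤ (suc n) (λ j → term k j))
      ≡⟨ sum-swap (suc n) (suc n) term ⟩
    sumℤ (suc n) (λ j → sumℤ (suc n) (λ k → term k j))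
      ≡⟨ sum-cong< (suc n) (λ j j<sn → collect j (ℕ.s≤s⁻¹ j<sn)) ⟩
    sumℤ (suc n) (λ j → u n j * powℤ (+ 2) (n ∸ 2 ℕ.* j)) ∎
    where
    term : ℕ → ℕ → ℤ
    term k j = binom n j * binom (n ℕ.+ j) j * (binom (n ∸ j) k * binom k j)

    regroup : ∀ a b c d → b * c * d * a ≡ a * c * d * b
    regroup = solve-∀

    regroup₂ : ∀ a b c d → a * b * c * d ≡ a * c * (b * d)
    regroup₂ = solve-∀

    expand : ∀ k → k ≤ n → binom n k * binom n k * binom n k ≡ sumℤ (suc n) (λ j → term k j)
    expand k k≤n = begin
      binom n k * binom n k * binom n k
        ≡⟨ cong (_* binom n k) (binom-square k≤n) ⟩
      sumℤ (suc n) (λ j → binom k j * binom (n ∸ k) j * binom (n ℕ.+ j) j) * binom n k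
        ≡⟨ sum-* (suc n) (binom n k) _ ⟩
      sumℤ (suc n) (λ j → binom k j * binom (n ∸ k) j * binom (n ℕ.+ j) j * binom n k)
        ≡⟨ sum-cong (suc n) (λ j → begin
             binom k j * binom (n ∸ k) j * binom (n ℕ.+ j) j * binom n k
               ≡⟨ regroup (binom n k) (binom k j) (binom (n ∸ k) j) (binom (n ℕ.+ j) j) ⟩
             binom n k * binom (n ∸ k) j * binom (n ℕ.+ j) j * binom k j
               ≡⟨ cong (λ b → b * binom (n ℕ.+ j) j * binom k j) (trinomial-comm n k j) ⟩
             binom n j * binom (n ∸ j) k * binom (n ℕ.+ j) j * binom k j
               ≡⟨ regroup₂ (binom n j) (binom (n ∸ j) k) (binom (n ℕ.+ j) j) (binom k j) ⟩
             term k j ∎) ⟩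
      sumℤ (suc n) (λ j → term k j) ∎

    regroup₃ : ∀ a b c → a * b * c ≡ a * c * b
    regroup₃ = solve-∀

    collect : ∀ j → j ≤ n → sumℤ (suc n) (λ k → term k j) ≡ u n j * powℤ (+ 2) (n ∸ 2 ℕ.* j)
    collect j j≤n = begin
      sumℤ (suc n) (λ k → term k j)
        ≡⟨ sum-skip-≤ n j (λ k → term k j) j≤n (λ k k<j →
             *-0ʳ (binom n j * binom (n ℕ.+ j) j) (*-0ʳ (binom (n ∸ j) k) (binom-0 k<j))) ⟩
      sumℤ (suc (n ∸ j)) (λ a → term (j ℕ.+ a) j)
        ≡⟨ sum-cong (suc (n ∸ j)) (λ a →
             trans (cong (binom n j * binom (n ℕ.+ j) j *_) (trinomial (n ∸ j) j a))
                   (sym (ℤ.*-assoc (binom n j * binom (n ℕ.+ j) j) (binom (n ∸ j) j) (binom (n ∸ j ∸ j) a)))) ⟩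
      sumℤ (suc (n ∸ j)) (λ a → binom n j * binom (n ℕ.+ j) j * binom (n ∸ j) j * binom (n ∸ j ∸ j) a)
        ≡⟨ *-sum (suc (n ∸ j)) (binom n j * binom (n ℕ.+ j) j * binom (n ∸ j) j) _ ⟨
      binom n j * binom (n ℕ.+ j) j * binom (n ∸ j) j * sumℤ (suc (n ∸ j)) (binom (n ∸ j ∸ j))
        ≡⟨ cong₂ _*_ (trans (regroup₃ (binom n j) (binom (n ℕ.+ j) j) (binom (n ∸ j) j)) (u-multinomial n j))
                     (row-sum (n ∸ j ∸ j) (suc (n ∸ j)) (s≤s (ℕ.m∸n≤m (n ∸ j) j))) ⟩
      u n j * powℤ (+ 2) (n ∸ j ∸ j)
        ≡⟨ cong (λ m → u n j * powℤ (+ 2) m)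
                (trans (ℕ.∸-+-assoc n j j) (cong (λ l → n ∸ (j ℕ.+ l)) (sym (ℕ.+-identityʳ j)))) ⟩
      u n j * powℤ (+ 2) (n ∸ 2 ℕ.* j) ∎

  -- Franel's recurrence by creative telescoping

  pos-∸ : ∀ {m n} → n ≤ m → + (m ∸ n) ≡ + m - + n
  pos-∸ {m} {n} n≤m = begin
    + (m ∸ n)                    ≡⟨ ℤ.⊖-≥ n≤m ⟨
    m ℤ.⊖ n                      ≡⟨ ℤ.m-n≡m⊖n m n ⟨
    + m - + n                    ∎

  binom-n-1 : ∀ n → binom n 1 ≡ + n
  binom-n-1 n = trans (sym (binom-C n 1)) (cong +_ (nC1≡n n))

  binom-suc-k : ∀ n k → + suc k * binom n (suc k) ≡ (+ n - + k) * binom n k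
  binom-suc-k n k = begin
    + suc k * binom n (suc k)
      ≡⟨ ℤ.*-comm (+ suc k) (binom n (suc k)) ⟩
    binom n (suc k) * + suc k
      ≡⟨ cong₂ (λ l b → binom n l * b) (ℕ.+-comm 1 k)
               (sym (trans (binom-sym k 1) (trans (binom-n-1 (k ℕ.+ 1)) (cong +_ (ℕ.+-comm k 1))))) ⟩
    binom n (k ℕ.+ 1) * binom (k ℕ.+ 1) k
      ≡⟨ trinomial n k 1 ⟩
    binom n k * binom (n ∸ k) 1
      ≡⟨ cong (binom n k *_) (binom-n-1 (n ∸ k)) ⟩
    binom n k * + (n ∸ k)
      ≡⟨ signed ⟩
    (+ n - + k) * binom n k ∎
    where
    signed : binom n k * + (n ∸ k) ≡ (+ n - + k) * binom n k
    signed with k ℕ.≤? n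
    ... | yes k≤n = trans (cong (binom n k *_) (pos-∸ k≤n)) (ℤ.*-comm (binom n k) (+ n - + k))
    -- Here the truncated and the signed difference disagree, but C(n,k) = 0.
    ... | no k≰n = trans (*-0ˡ (+ (n ∸ k)) (binom-0 (ℕ.≰⇒> k≰n))) (sym (*-0ʳ (+ n - + k) (binom-0 (ℕ.≰⇒> k≰n))))

  binom-suc-suc : ∀ n k → + suc k * binom (suc n) (suc k) ≡ + suc n * binom n k
  binom-suc-suc n k = begin
    + suc k * binom (suc n) (suc k)
      ≡⟨ cong (+ suc k *_) (pascal n k) ⟩
    + suc k * (binom n k + binom n (suc k))
      ≡⟨ ℤ.*-distribˡ-+ (+ suc k) (binom n k) (binom n (suc k)) ⟩
    + suc k * binom n k + + suc k * binom n (suc k)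
      ≡⟨ cong (λ z → + suc k * binom n k + z) (binom-suc-k n k) ⟩
    + suc k * binom n k + (+ n - + k) * binom n k
      ≡⟨ collect (+ k) (+ n) (binom n k) ⟩
    + suc n * binom n k ∎
    where
    collect : ∀ k n b → (+ 1 + k) * b + (n - k) * b ≡ (+ 1 + n) * b
    collect = solve-∀

  c-factorial : ∀ j → c j * + (j ! ℕ.* (j ! ℕ.* j !)) ≡ + ((3 ℕ.* j) !)
  c-factorial j = begin
    c j * + (j ! ℕ.* (j ! ℕ.* j !))
      ≡⟨ cong₂ (λ x y → x * y * + (j ! ℕ.* (j ! ℕ.* j !))) (sym (binom-C (2 ℕ.* j) j)) (sym (binom-C (3 ℕ.* j) j)) ⟩
    + ((2 ℕ.* j) C j) * + ((3 ℕ.* j) C j) * + (j ! ℕ.* (j ! ℕ.* j !))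
      ≡⟨ pos-*₃ ((2 ℕ.* j) C j) ((3 ℕ.* j) C j) (j ! ℕ.* (j ! ℕ.* j !)) ⟨
    + (((2 ℕ.* j) C j) ℕ.* ((3 ℕ.* j) C j) ℕ.* (j ! ℕ.* (j ! ℕ.* j !)))
      ≡⟨ cong +_ (regroup ((2 ℕ.* j) C j) ((3 ℕ.* j) C j) (j !)) ⟩
    + (((3 ℕ.* j) C j) ℕ.* (j ! ℕ.* (((2 ℕ.* j) C j) ℕ.* (j ! ℕ.* j !))))
      ≡⟨ cong (λ z → + (((3 ℕ.* j) C j) ℕ.* (j ! ℕ.* z)))
              (trans (cong (λ m → ((2 ℕ.* j) C j) ℕ.* (j ! ℕ.* m !)) (sym (ℕ.+-identityʳ j)))
                     (C-factorial j (j ℕ.+ 0))) ⟩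
    + (((3 ℕ.* j) C j) ℕ.* (j ! ℕ.* (2 ℕ.* j) !))
      ≡⟨ cong +_ (C-factorial j (2 ℕ.* j)) ⟩
    + ((3 ℕ.* j) !) ∎
    where
    regroup : ∀ a b f → a ℕ.* b ℕ.* (f ℕ.* (f ℕ.* f)) ≡ b ℕ.* (f ℕ.* (a ℕ.* (f ℕ.* f)))
    regroup = ℕSolver.solve-∀

  cube : ℤ → ℤ
  cube x = x * x * x

  3*suc : ∀ j → 3 ℕ.* suc j ≡ 3 ℕ.+ 3 ℕ.* j
  3*suc = ℕSolver.solve-∀

  -- The quotient (3j+3)!/(3j)!, read off from c_j j!³ = (3j)! at j and j+1 with the common j!³
  -- cancelled.
  c-suc : ∀ j → cube (+ suc j) * c (suc j)
    ≡ + (3 ℕ.+ 3 ℕ.* j) * + (2 ℕ.+ 3 ℕ.* j) * + (1 ℕ.+ 3 ℕ.* j) * c j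
  c-suc j = ℤ.*-cancelʳ-≡ _ _ (+ F) (begin
    cube (+ suc j) * c (suc j) * + F
      ≡⟨ move (cube (+ suc j)) (c (suc j)) (+ F) ⟩
    c (suc j) * (cube (+ suc j) * + F)
      ≡⟨ cong (c (suc j) *_) cube-F ⟩
    c (suc j) * + (suc j ! ℕ.* (suc j ! ℕ.* suc j !))
      ≡⟨ c-factorial (suc j) ⟩
    + ((3 ℕ.* suc j) !)
      ≡⟨ cong (λ m → + (m !)) (3*suc j) ⟩
    + ((3 ℕ.+ 3 ℕ.* j) !)
      ≡⟨ trans (ℤ.pos-* (3 ℕ.+ 3 ℕ.* j) ((2 ℕ.+ 3 ℕ.* j) !)) (cong (+ (3 ℕ.+ 3 ℕ.* j) *_)
           (trans (ℤ.pos-* (2 ℕ.+ 3 ℕ.* j) ((1 ℕ.+ 3 ℕ.* j) !)) (cong (+ (2 ℕ.+ 3 ℕ.* j) *_) (ℤ.pos-* (1 ℕ.+ 3 ℕ.* j) ((3 ℕ.* j) !))))) ⟩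
    a₃ * (a₂ * (a₁ * + ((3 ℕ.* j) !)))
      ≡⟨ cong (λ z → a₃ * (a₂ * (a₁ * z))) (c-factorial j) ⟨
    a₃ * (a₂ * (a₁ * (c j * + F)))
      ≡⟨ reassoc a₃ a₂ a₁ (c j) (+ F) ⟩
    a₃ * a₂ * a₁ * c j * + F ∎)
    where
    F = j ! ℕ.* (j ! ℕ.* j !)
    a₃ = + (3 ℕ.+ 3 ℕ.* j)
    a₂ = + (2 ℕ.+ 3 ℕ.* j)
    a₁ = + (1 ℕ.+ 3 ℕ.* j)
    instance
      F≢0 : ℕ.NonZero F
      F≢0 = ℕ.m*n≢0 (j !) (j ! ℕ.* j !) {{j ℕ.!≢0}} {{j ℕ.!* j !≢0}}
    move : ∀ x y z → x * y * z ≡ y * (x * z)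
    move = solve-∀
    reassoc : ∀ x y z v w → x * (y * (z * (v * w))) ≡ x * y * z * v * w
    reassoc = solve-∀
    ℕ-cube : ∀ s f → s ℕ.* s ℕ.* s ℕ.* (f ℕ.* (f ℕ.* f)) ≡ s ℕ.* f ℕ.* (s ℕ.* f ℕ.* (s ℕ.* f))
    ℕ-cube = ℕSolver.solve-∀
    cube-F : cube (+ suc j) * + F ≡ + (suc j ! ℕ.* (suc j ! ℕ.* suc j !))
    cube-F = begin
      cube (+ suc j) * + F                      ≡⟨ cong (_* + F) (pos-*₃ (suc j) (suc j) (suc j)) ⟨
      + (suc j ℕ.* suc j ℕ.* suc j) * + F       ≡⟨ ℤ.pos-* (suc j ℕ.* suc j ℕ.* suc j) F ⟨
      + (suc j ℕ.* suc j ℕ.* suc j ℕ.* F)       ≡⟨ cong +_ (ℕ-cube (suc j) (j !)) ⟩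
      + (suc j ! ℕ.* (suc j ! ℕ.* suc j !))     ∎

  pos-2* : ∀ j → + (2 ℕ.* j) ≡ + 2 * + j
  pos-2* j = ℤ.pos-* 2 j

  pos-3* : ∀ j → + (3 ℕ.* j) ≡ + 3 * + j
  pos-3* j = ℤ.pos-* 3 j

  -- Three one-step ratios b_{i+1}/b_i = x_{i+1}/a_{i+1} are composed. Their denominators a₁, a₂, a₃
  -- are exactly the numerator of c'/c, so they drop out without any division.
  u-chain : ∀ s c c' a₁ a₂ a₃ x₁ x₂ x₃ b₀ b₁ b₂ b₃ →
    a₃ * b₃ ≡ x₃ * b₂ → a₂ * b₂ ≡ x₂ * b₁ → a₁ * b₁ ≡ x₁ * b₀ → s * c' ≡ a₃ * a₂ * a₁ * c →
    s * (b₃ * c') ≡ x₃ * x₂ * (x₁ * (b₀ * c))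
  u-chain s c c' a₁ a₂ a₃ x₁ x₂ x₃ b₀ b₁ b₂ b₃ e₃ e₂ e₁ e = begin
    s * (b₃ * c')                        ≡⟨ s₁ s b₃ c' ⟩
    b₃ * (s * c')                        ≡⟨ cong (b₃ *_) e ⟩
    b₃ * (a₃ * a₂ * a₁ * c)              ≡⟨ s₂ b₃ a₃ a₂ a₁ c ⟩
    a₂ * a₁ * c * (a₃ * b₃)              ≡⟨ cong (a₂ * a₁ * c *_) e₃ ⟩
    a₂ * a₁ * c * (x₃ * b₂)              ≡⟨ s₃ a₂ a₁ c x₃ b₂ ⟩
    a₁ * c * x₃ * (a₂ * b₂)              ≡⟨ cong (a₁ * c * x₃ *_) e₂ ⟩
    a₁ * c * x₃ * (x₂ * b₁)              ≡⟨ s₄ a₁ c x₃ x₂ b₁ ⟩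
    c * x₃ * x₂ * (a₁ * b₁)              ≡⟨ cong (c * x₃ * x₂ *_) e₁ ⟩
    c * x₃ * x₂ * (x₁ * b₀)              ≡⟨ s₅ c x₃ x₂ x₁ b₀ ⟩
    x₃ * x₂ * (x₁ * (b₀ * c))            ∎
    where
    s₁ : ∀ s b c → s * (b * c) ≡ b * (s * c)
    s₁ = solve-∀
    s₂ : ∀ b x y z c → b * (x * y * z * c) ≡ y * z * c * (x * b)
    s₂ = solve-∀
    s₃ : ∀ a b c x y → a * b * c * (x * y) ≡ b * c * x * (a * y)
    s₃ = solve-∀
    s₄ : ∀ a c x y b → a * c * x * (y * b) ≡ c * x * y * (a * b)
    s₄ = solve-∀
    s₅ : ∀ c x y z b → c * x * y * (z * b) ≡ x * y * (z * (b * c))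
    s₅ = solve-∀

  module _ (n j : ℕ) where
    private
      N = + n
      J = + suc j
      -- Each path below starts with the step from C(n+j,3j) to C(n+j,3j+1), whose numerator n-2j is
      -- absorbed here. Thus all neighbours at `suc j` are polynomial multiples of the same `D`.
      D = (N - + 2 * + j) * u n j

      shift₁ : + (n ℕ.+ j) - + (3 ℕ.* j) ≡ N - + 2 * + j
      shift₁ = trans (cong₂ _-_ (ℤ.pos-+ n j) (pos-3* j)) (ring N (+ j))
        where
        ring : ∀ n j → n + j - + 3 * j ≡ n - + 2 * j
        ring = solve-∀

      shift₂ : + (n ℕ.+ j) - + (1 ℕ.+ 3 ℕ.* j) ≡ N - + 2 * J + + 1
      shift₂ = trans (cong₂ (λ x y → x - (+ 1 + y)) (ℤ.pos-+ n j) (pos-3* j)) (ring N (+ j))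
        where
        ring : ∀ n j → n + j - (+ 1 + + 3 * j) ≡ n - + 2 * (+ 1 + j) + + 1
        ring = solve-∀

      shift₃ : + (n ℕ.+ j) - + (2 ℕ.+ 3 ℕ.* j) ≡ N - + 2 * J
      shift₃ = trans (cong₂ (λ x y → x - (+ 2 + y)) (ℤ.pos-+ n j) (pos-3* j)) (ring N (+ j))
        where
        ring : ∀ n j → n + j - (+ 2 + + 3 * j) ≡ n - + 2 * (+ 1 + j)
        ring = solve-∀

      shift₄ : + suc (n ℕ.+ j) ≡ N + J
      shift₄ = trans (cong +_ (sym (ℕ.+-suc n j))) (ℤ.pos-+ n (suc j))

      shift₅ : + suc (suc (n ℕ.+ j)) ≡ N + + 1 + J
      shift₅ = trans (cong (λ z → + 1 + z) shift₄) (ring N J)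
        where
        ring : ∀ n j → + 1 + (n + j) ≡ n + + 1 + j
        ring = solve-∀

      step₁ : + (1 ℕ.+ 3 ℕ.* j) * binom (n ℕ.+ j) (1 ℕ.+ 3 ℕ.* j) ≡ (N - + 2 * + j) * binom (n ℕ.+ j) (3 ℕ.* j)
      step₁ = trans (binom-suc-k (n ℕ.+ j) (3 ℕ.* j)) (cong (_* binom (n ℕ.+ j) (3 ℕ.* j)) shift₁)

    -- This lemma and the next two go from C(n+j,3j) to lower index 3j+3 in rows n+j+2, n+j+1 and
    -- n+j. They differ in how many steps also raise the upper index: two, one or none.
    u-suc-suc : cube J * u (suc n) (suc j) ≡ (N + + 1 + J) * (N + J) * D
    u-suc-suc = trans
      (cong (λ b → cube J * (b * c (suc j))) (cong₂ binom (cong suc (ℕ.+-suc n j)) (3*suc j)))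
      (u-chain (cube J) (c j) (c (suc j)) (+ (1 ℕ.+ 3 ℕ.* j)) (+ (2 ℕ.+ 3 ℕ.* j)) (+ (3 ℕ.+ 3 ℕ.* j)) (N - + 2 * + j) (N + J) (N + + 1 + J)
        (binom (n ℕ.+ j) (3 ℕ.* j)) (binom (n ℕ.+ j) (1 ℕ.+ 3 ℕ.* j)) (binom (1 ℕ.+ (n ℕ.+ j)) (2 ℕ.+ 3 ℕ.* j)) _
        (trans (binom-suc-suc (suc (n ℕ.+ j)) (2 ℕ.+ 3 ℕ.* j)) (cong (_* binom (1 ℕ.+ (n ℕ.+ j)) (2 ℕ.+ 3 ℕ.* j)) shift₅))
        (trans (binom-suc-suc (n ℕ.+ j) (1 ℕ.+ 3 ℕ.* j)) (cong (_* binom (n ℕ.+ j) (1 ℕ.+ 3 ℕ.* j)) shift₄))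
        step₁ (c-suc j))

    u-same-suc : cube J * u n (suc j) ≡ (N + J) * (N - + 2 * J + + 1) * D
    u-same-suc = trans
      (cong (λ b → cube J * (b * c (suc j))) (cong₂ binom (ℕ.+-suc n j) (3*suc j)))
      (u-chain (cube J) (c j) (c (suc j)) (+ (1 ℕ.+ 3 ℕ.* j)) (+ (2 ℕ.+ 3 ℕ.* j)) (+ (3 ℕ.+ 3 ℕ.* j)) (N - + 2 * + j) (N - + 2 * J + + 1) (N + J)
        (binom (n ℕ.+ j) (3 ℕ.* j)) (binom (n ℕ.+ j) (1 ℕ.+ 3 ℕ.* j)) (binom (n ℕ.+ j) (2 ℕ.+ 3 ℕ.* j)) _
        (trans (binom-suc-suc (n ℕ.+ j) (2 ℕ.+ 3 ℕ.* j)) (cong (_* binom (n ℕ.+ j) (2 ℕ.+ 3 ℕ.* j)) shift₄))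
        (trans (binom-suc-k (n ℕ.+ j) (1 ℕ.+ 3 ℕ.* j)) (cong (_* binom (n ℕ.+ j) (1 ℕ.+ 3 ℕ.* j)) shift₂))
        step₁ (c-suc j))

    u-pred-suc : ∀ m → n ≡ suc m → cube J * u m (suc j) ≡ (N - + 2 * J) * (N - + 2 * J + + 1) * D
    u-pred-suc m n≡1+m = trans
      (cong (λ b → cube J * (b * c (suc j))) (cong₂ binom (trans (ℕ.+-suc m j) (cong (ℕ._+ j) (sym n≡1+m))) (3*suc j)))
      (u-chain (cube J) (c j) (c (suc j)) (+ (1 ℕ.+ 3 ℕ.* j)) (+ (2 ℕ.+ 3 ℕ.* j)) (+ (3 ℕ.+ 3 ℕ.* j)) (N - + 2 * + j) (N - + 2 * J + + 1) (N - + 2 * J)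
        (binom (n ℕ.+ j) (3 ℕ.* j)) (binom (n ℕ.+ j) (1 ℕ.+ 3 ℕ.* j)) (binom (n ℕ.+ j) (2 ℕ.+ 3 ℕ.* j)) _
        (trans (binom-suc-k (n ℕ.+ j) (2 ℕ.+ 3 ℕ.* j)) (cong (_* binom (n ℕ.+ j) (2 ℕ.+ 3 ℕ.* j)) shift₃))
        (trans (binom-suc-k (n ℕ.+ j) (1 ℕ.+ 3 ℕ.* j)) (cong (_* binom (n ℕ.+ j) (1 ℕ.+ 3 ℕ.* j)) shift₂))
        step₁ (c-suc j))

  u-0 : ∀ {n j} → n < 2 ℕ.* j → u n j ≡ + 0
  u-0 {n} {j} n<2j = *-0ˡ (c j) (binom-0
    (subst (n ℕ.+ j <_) (ℕ.+-comm (2 ℕ.* j) j) (ℕ.+-monoˡ-< j n<2j)))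

  -- For 2j > e the truncated exponent does not increase with `e`, but then n < 2j and u n j = 0.
  2u-power : ∀ {n e} j → n ≤ e →
    + 2 * (u n j * powℤ (+ 2) (e ∸ 2 ℕ.* j)) ≡ u n j * powℤ (+ 2) (suc e ∸ 2 ℕ.* j)
  2u-power {n} {e} j n≤e with 2 ℕ.* j ℕ.≤? e
  ... | yes 2j≤e = trans (ring (u n j) (powℤ (+ 2) (e ∸ 2 ℕ.* j)))
                         (cong (λ k → u n j * powℤ (+ 2) k) (sym (ℕ.+-∸-assoc 1 2j≤e)))
    where
    ring : ∀ u p → + 2 * (u * p) ≡ u * (+ 2 * p)
    ring = solve-∀
  ... | no 2j≰e = trans (*-0ʳ (+ 2) (*-0ˡ (powℤ (+ 2) (e ∸ 2 ℕ.* j)) u≡0)) (sym (*-0ˡ (powℤ (+ 2) (suc e ∸ 2 ℕ.* j)) u≡0))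
    where u≡0 = u-0 (ℕ.≤-<-trans n≤e (ℕ.≰⇒> 2j≰e))

  -- The summand of MacMahon's formula.
  t : ℕ → ℕ → ℤ
  t n j = u n j * powℤ (+ 2) (n ∸ 2 ℕ.* j)

  -- Puts the certificate at j in terms of the power of 2 that belongs to j+1. Truncation would
  -- spoil this from 2j = n on, where the true exponent on the right is negative; at 2j = n the
  -- weight vanishes, and beyond it `u` does.
  t-weighted : ∀ n j → (+ n - + 2 * + j) * t n j
    ≡ + 2 * powℤ (+ 2) (suc n ∸ 2 ℕ.* suc j) * ((+ n - + 2 * + j) * u n j)
  t-weighted n j with ℕ.<-cmp (2 ℕ.* j) n
  ... | tri< 2j<n _ _ = trans
    (cong (λ k → (+ n - + 2 * + j) * (u n j * powℤ (+ 2) k)) exponent)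
    (ring (+ n - + 2 * + j) (u n j) (powℤ (+ 2) (suc n ∸ 2 ℕ.* suc j)))
    where
    exponent : n ∸ 2 ℕ.* j ≡ suc (suc n ∸ 2 ℕ.* suc j)
    exponent = trans (ℕ.+-∸-assoc 1 2j<n) (cong (λ k → suc (n ∸ k)) (sym (ℕ.+-suc j (j ℕ.+ 0))))
    ring : ∀ x u p → x * (u * (+ 2 * p)) ≡ + 2 * p * (x * u)
    ring = solve-∀
  ... | tri≈ _ 2j≡n _ = trans (*-0ˡ (t n j) zero-factor)
    (sym (*-0ʳ (+ 2 * powℤ (+ 2) (suc n ∸ 2 ℕ.* suc j)) (*-0ˡ (u n j) zero-factor)))
    where
    zero-factor : + n - + 2 * + j ≡ + 0
    zero-factor = ℤ.i≡j⇒i-j≡0 (trans (cong +_ (sym 2j≡n)) (pos-2* j))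
  ... | tri> _ _ n<2j = trans (*-0ʳ (+ n - + 2 * + j) (*-0ˡ (powℤ (+ 2) (n ∸ 2 ℕ.* j)) (u-0 n<2j)))
    (sym (*-0ʳ (+ 2 * powℤ (+ 2) (suc n ∸ 2 ℕ.* suc j)) (*-0ʳ (+ n - + 2 * + j) (u-0 n<2j))))

  quad : ℤ → ℤ
  quad n = + 7 * n * n + + 7 * n + + 2

  -- Franel's recurrence says that this vanishes at x = f_{n+1}, y = f_n, z = f_{n-1}.
  franel-operator : ℤ → ℤ → ℤ → ℤ → ℤ
  franel-operator n x y z = (n + + 1) * (n + + 1) * x - quad n * y - + 8 * n * n * z

  -- After multiplication by 4j³ every term becomes a polynomial multiple of
  -- D = (n − 2(j−1)) u n (j−1) and of P = 2^{n+1−2j}; the left and right sides are those of t-step.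
  zeilberger-certificate : ∀ n j D P a b c y z →
    cube j * a ≡ (n + + 1 + j) * (n + j) * D →
    cube j * b ≡ (n + j) * (n - + 2 * j + + 1) * D →
    cube j * c ≡ (n - + 2 * j) * (n - + 2 * j + + 1) * D →
    + 2 * y ≡ b * P → + 2 * (+ 2 * z) ≡ c * P →
    + 4 * cube j * franel-operator n (a * P) y z
    ≡ + 4 * cube j * (- + 3 * (+ 3 * n + + 1) * ((n - + 2 * j) * y - + 2 * P * D))
  zeilberger-certificate n j D P a b c y z ea eb ec ey ez = begin
    + 4 * cube j * franel-operator n (a * P) y z
      ≡⟨ s₁ n j P a y z ⟩
    + 4 * (n + + 1) * (n + + 1) * (cube j * a) * P - quad n * + 2 * cube j * (+ 2 * y)
      - + 8 * n * n * cube j * (+ 2 * (+ 2 * z))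
      ≡⟨ cong₂ (λ y z → + 4 * (n + + 1) * (n + + 1) * (cube j * a) * P - quad n * + 2 * cube j * y
                   - + 8 * n * n * cube j * z) ey ez ⟩
    + 4 * (n + + 1) * (n + + 1) * (cube j * a) * P - quad n * + 2 * cube j * (b * P)
      - + 8 * n * n * cube j * (c * P)
      ≡⟨ s₂ n j P a b c ⟩
    + 4 * (n + + 1) * (n + + 1) * (cube j * a) * P - quad n * + 2 * (cube j * b) * P
      - + 8 * n * n * (cube j * c) * P
      ≡⟨ cong₂ (λ a c → + 4 * (n + + 1) * (n + + 1) * a * P - quad n * + 2 * (cube j * b) * P
                   - + 8 * n * n * c * P) ea ec ⟩
    + 4 * (n + + 1) * (n + + 1) * ((n + + 1 + j) * (n + j) * D) * P - quad n * + 2 * (cube j * b) * P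
      - + 8 * n * n * ((n - + 2 * j) * (n - + 2 * j + + 1) * D) * P
      ≡⟨ cong (λ b → + 4 * (n + + 1) * (n + + 1) * ((n + + 1 + j) * (n + j) * D) * P - quad n * + 2 * b * P
                   - + 8 * n * n * ((n - + 2 * j) * (n - + 2 * j + + 1) * D) * P) eb ⟩
    + 4 * (n + + 1) * (n + + 1) * ((n + + 1 + j) * (n + j) * D) * P
      - quad n * + 2 * ((n + j) * (n - + 2 * j + + 1) * D) * P
      - + 8 * n * n * ((n - + 2 * j) * (n - + 2 * j + + 1) * D) * P
      -- The heart of the certificate: with every term now a multiple of D·P, the claim is a
      -- polynomial identity in n and j.
      ≡⟨ s₃ n j D P ⟩
    - + 3 * (+ 3 * n + + 1) * (+ 2 * (n - + 2 * j) * ((n + j) * (n - + 2 * j + + 1) * D) * P - + 8 * cube j * P * D)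
      ≡⟨ cong (λ b → - + 3 * (+ 3 * n + + 1) * (+ 2 * (n - + 2 * j) * b * P - + 8 * cube j * P * D)) eb ⟨
    - + 3 * (+ 3 * n + + 1) * (+ 2 * (n - + 2 * j) * (cube j * b) * P - + 8 * cube j * P * D)
      ≡⟨ s₄ n j D P b ⟩
    - + 3 * (+ 3 * n + + 1) * (+ 2 * (n - + 2 * j) * cube j * (b * P) - + 8 * cube j * P * D)
      ≡⟨ cong (λ y → - + 3 * (+ 3 * n + + 1) * (+ 2 * (n - + 2 * j) * cube j * y - + 8 * cube j * P * D)) ey ⟨
    - + 3 * (+ 3 * n + + 1) * (+ 2 * (n - + 2 * j) * cube j * (+ 2 * y) - + 8 * cube j * P * D)
      ≡⟨ s₅ n j D P y ⟩
    + 4 * cube j * (- + 3 * (+ 3 * n + + 1) * ((n - + 2 * j) * y - + 2 * P * D)) ∎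
    where
    s₁ : ∀ n j P a y z →
      + 4 * (j * j * j) * ((n + + 1) * (n + + 1) * (a * P) - (+ 7 * n * n + + 7 * n + + 2) * y - + 8 * n * n * z)
      ≡ + 4 * (n + + 1) * (n + + 1) * (j * j * j * a) * P
        - (+ 7 * n * n + + 7 * n + + 2) * + 2 * (j * j * j) * (+ 2 * y)
        - + 8 * n * n * (j * j * j) * (+ 2 * (+ 2 * z))
    s₁ = solve-∀
    s₂ : ∀ n j P a b c →
      + 4 * (n + + 1) * (n + + 1) * (j * j * j * a) * P
        - (+ 7 * n * n + + 7 * n + + 2) * + 2 * (j * j * j) * (b * P) - + 8 * n * n * (j * j * j) * (c * P)
      ≡ + 4 * (n + + 1) * (n + + 1) * (j * j * j * a) * P
        - (+ 7 * n * n + + 7 * n + + 2) * + 2 * (j * j * j * b) * P - + 8 * n * n * (j * j * j * c) * P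
    s₂ = solve-∀
    s₃ : ∀ n j D P →
      + 4 * (n + + 1) * (n + + 1) * ((n + + 1 + j) * (n + j) * D) * P
        - (+ 7 * n * n + + 7 * n + + 2) * + 2 * ((n + j) * (n - + 2 * j + + 1) * D) * P
        - + 8 * n * n * ((n - + 2 * j) * (n - + 2 * j + + 1) * D) * P
      ≡ - + 3 * (+ 3 * n + + 1)
        * (+ 2 * (n - + 2 * j) * ((n + j) * (n - + 2 * j + + 1) * D) * P - + 8 * (j * j * j) * P * D)
    s₃ = solve-∀
    s₄ : ∀ n j D P b →
      - + 3 * (+ 3 * n + + 1) * (+ 2 * (n - + 2 * j) * (j * j * j * b) * P - + 8 * (j * j * j) * P * D)
      ≡ - + 3 * (+ 3 * n + + 1) * (+ 2 * (n - + 2 * j) * (j * j * j) * (b * P) - + 8 * (j * j * j) * P * D)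
    s₄ = solve-∀
    s₅ : ∀ n j D P y →
      - + 3 * (+ 3 * n + + 1) * (+ 2 * (n - + 2 * j) * (j * j * j) * (+ 2 * y) - + 8 * (j * j * j) * P * D)
      ≡ + 4 * (j * j * j) * (- + 3 * (+ 3 * n + + 1) * ((n - + 2 * j) * y - + 2 * P * D))
    s₅ = solve-∀

  module _ (m : ℕ) where
    private
      n = suc m
      N = + n

    -- The operator applied to the summand is a difference G(i+1) - G(i) with G(j) = -3(3n+1)(n-2j)
    -- t n j. The term 2PD of the certificate is G's value at i in the form given by `t-weighted`.
    t-step : ∀ i → franel-operator N (t (suc n) (suc i)) (t n (suc i)) (t m (suc i))
      ≡ - + 3 * (+ 3 * N + + 1) * ((N - + 2 * + suc i) * t n (suc i) - (N - + 2 * + i) * t n i)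
    t-step i = ℤ.*-cancelˡ-≡ (+ 4 * cube (+ suc i)) _ _ (trans
      (zeilberger-certificate N (+ suc i) ((N - + 2 * + i) * u n i) (powℤ (+ 2) (suc n ∸ 2 ℕ.* suc i))
        (u (suc n) (suc i)) (u n (suc i)) (u m (suc i)) (t n (suc i)) (t m (suc i))
        (u-suc-suc n i) (u-same-suc n i) (u-pred-suc n i m refl)
        (2u-power (suc i) ℕ.≤-refl)
        (trans (cong (+ 2 *_) (2u-power (suc i) ℕ.≤-refl)) (2u-power (suc i) (ℕ.n≤1+n m))))
      (cong (λ z → + 4 * cube (+ suc i) * (- + 3 * (+ 3 * N + + 1) * ((N - + 2 * + suc i) * t n (suc i) - z)))
            (sym (t-weighted n i))))

    t-telescope : ∀ J → sumℤ (suc J) (λ j → franel-operator N (t (suc n) j) (t n j) (t m j))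
      ≡ - + 3 * (+ 3 * N + + 1) * ((N - + 2 * + J) * t n J)
    t-telescope zero = begin
      + 0 + franel-operator N (t (suc n) 0) (t n 0) (t m 0)
        ≡⟨ ℤ.+-identityˡ _ ⟩
      franel-operator N (t (suc n) 0) (t n 0) (t m 0)
        ≡⟨ cong₂ (λ x y → franel-operator N (x * powℤ (+ 2) (2 ℕ.+ m)) (y * powℤ (+ 2) (1 ℕ.+ m)) (t m 0))
                 (u-n-0 (suc n)) (u-n-0 n) ⟩
      franel-operator N (+ 1 * powℤ (+ 2) (2 ℕ.+ m)) (+ 1 * powℤ (+ 2) (1 ℕ.+ m)) (t m 0)
        ≡⟨ cong (λ z → franel-operator N (+ 1 * powℤ (+ 2) (2 ℕ.+ m)) (+ 1 * powℤ (+ 2) (1 ℕ.+ m)) (z * powℤ (+ 2) m))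
                (u-n-0 m) ⟩
      franel-operator N (+ 1 * powℤ (+ 2) (2 ℕ.+ m)) (+ 1 * powℤ (+ 2) (1 ℕ.+ m)) (+ 1 * powℤ (+ 2) m)
        -- The term j = 0 starts the telescope, because 4(n+1)² - 2(7n²+7n+2) - 8n² = -6n(3n+1).
        ≡⟨ ring N (powℤ (+ 2) m) ⟩
      - + 3 * (+ 3 * N + + 1) * ((N - + 2 * + 0) * (+ 1 * powℤ (+ 2) n))
        ≡⟨ cong (λ z → - + 3 * (+ 3 * N + + 1) * ((N - + 2 * + 0) * (z * powℤ (+ 2) n))) (u-n-0 n) ⟨
      - + 3 * (+ 3 * N + + 1) * ((N - + 2 * + 0) * t n 0) ∎
      where
      u-n-0 : ∀ n → u n 0 ≡ + 1
      u-n-0 n = cong₂ _*_ (binom-n-0 (n ℕ.+ 0)) (cong₂ _*_ (binom-n-0 0) (binom-n-0 0))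
      ring : ∀ n p → (n + + 1) * (n + + 1) * (+ 1 * (+ 2 * (+ 2 * p)))
          - (+ 7 * n * n + + 7 * n + + 2) * (+ 1 * (+ 2 * p)) - + 8 * n * n * (+ 1 * p)
        ≡ - + 3 * (+ 3 * n + + 1) * ((n - + 2 * + 0) * (+ 1 * (+ 2 * p)))
      ring = solve-∀
    t-telescope (suc J) = trans
      (cong₂ _+_ (t-telescope J) (t-step J))
      (ring (- + 3 * (+ 3 * N + + 1)) ((N - + 2 * + J) * t n J) ((N - + 2 * + suc J) * t n (suc J)))
      where
      ring : ∀ a x y → a * x + a * (y - x) ≡ a * y
      ring = solve-∀

    private
      t-0 : ∀ {l j} → l < j → t l j ≡ + 0
      t-0 {l} {j} l<j = *-0ˡ (powℤ (+ 2) (l ∸ 2 ℕ.* j)) (u-0 (ℕ.<-≤-trans l<j (ℕ.m≤m+n j (j ℕ.+ 0))))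

      fr-t : ∀ l → l ≤ suc n → fr l ≡ sumℤ (suc (suc n)) (t l)
      fr-t l l≤1+n = trans (macmahon l) (sym (sum-truncate (suc l) (suc (suc n)) (t l) (s≤s l≤1+n) λ _ → t-0))

    -- The three sums are padded to the common range j ≤ n+1. The telescoped value at j = n+1
    -- contains t n (n+1), which is 0.
    franel-recurrence : franel-operator N (fr (suc n)) (fr n) (fr m) ≡ + 0
    franel-recurrence = begin
      franel-operator N (fr (suc n)) (fr n) (fr m)
        ≡⟨ cong₂ (λ x y → franel-operator N x y (fr m)) (fr-t (suc n) ℕ.≤-refl) (fr-t n (ℕ.n≤1+n n)) ⟩
      franel-operator N (sumℤ M (t (suc n))) (sumℤ M (t n)) (fr m)
        ≡⟨ cong (franel-operator N (sumℤ M (t (suc n))) (sumℤ M (t n))) (fr-t m (ℕ.m≤n⇒m≤1+n (ℕ.n≤1+n m))) ⟩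
      franel-operator N (sumℤ M (t (suc n))) (sumℤ M (t n)) (sumℤ M (t m))
        ≡⟨ operator-sum M ⟨
      sumℤ M (λ j → franel-operator N (t (suc n) j) (t n j) (t m j))
        ≡⟨ t-telescope (suc n) ⟩
      - + 3 * (+ 3 * N + + 1) * ((N - + 2 * + suc n) * t n (suc n))
        ≡⟨ *-0ʳ (- + 3 * (+ 3 * N + + 1)) (*-0ʳ (N - + 2 * + suc n) (t-0 (ℕ.n<1+n n))) ⟩
      + 0 ∎
      where
      M = suc (suc n)
      ring₀ : ∀ n → (n + + 1) * (n + + 1) * + 0 - (+ 7 * n * n + + 7 * n + + 2) * + 0 - + 8 * n * n * + 0 ≡ + 0
      ring₀ = solve-∀
      ring : ∀ n x y z x' y' z' →
        ((n + + 1) * (n + + 1) * x - (+ 7 * n * n + + 7 * n + + 2) * y - + 8 * n * n * z)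
        + ((n + + 1) * (n + + 1) * x' - (+ 7 * n * n + + 7 * n + + 2) * y' - + 8 * n * n * z')
        ≡ (n + + 1) * (n + + 1) * (x + x') - (+ 7 * n * n + + 7 * n + + 2) * (y + y') - + 8 * n * n * (z + z')
      ring = solve-∀
      operator-sum : ∀ M → sumℤ M (λ j → franel-operator N (t (suc n) j) (t n j) (t m j))
        ≡ franel-operator N (sumℤ M (t (suc n))) (sumℤ M (t n)) (sumℤ M (t m))
      operator-sum zero = sym (ring₀ N)
      operator-sum (suc M) = trans
        (cong (λ z → z + franel-operator N (t (suc n) M) (t n M) (t m M)) (operator-sum M))
        (ring N (sumℤ M (t (suc n))) (sumℤ M (t n)) (sumℤ M (t m)) (t (suc n) M) (t n M) (t m M))

-- Arithmetic modulo a prime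

module PrimeFields where
  open import Data.Integer using (ℤ; _+_; _-_; _*_; -[1+_]; ∣_∣)
  open FranelNumbers

  binom-n-n : ∀ n → binom n n ≡ + 1
  binom-n-n n = trans (sym (binom-sym 0 n)) (binom-n-0 n)

  powℤ-+ : ∀ x m n → powℤ x (m ℕ.+ n) ≡ powℤ x m * powℤ x n
  powℤ-+ x zero    n = sym (ℤ.*-identityˡ _)
  powℤ-+ x (suc m) n = trans (cong (x *_) (powℤ-+ x m n)) (sym (ℤ.*-assoc x (powℤ x m) (powℤ x n)))

  powℤ-distrib-* : ∀ x y n → powℤ (x * y) n ≡ powℤ x n * powℤ y n
  powℤ-distrib-* x y zero    = refl
  powℤ-distrib-* x y (suc n) = trans (cong (x * y *_) (powℤ-distrib-* x y n)) (ring x y (powℤ x n) (powℤ y n))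
    where
    ring : ∀ x y p q → x * y * (p * q) ≡ x * p * (y * q)
    ring = solve-∀

  powℤ-powℤ : ∀ x m n → powℤ (powℤ x m) n ≡ powℤ x (m ℕ.* n)
  powℤ-powℤ x zero    n = powℤ-1 n
  powℤ-powℤ x (suc m) n = trans (powℤ-distrib-* x (powℤ x m) n)
    (trans (cong (powℤ x n *_) (powℤ-powℤ x m n)) (sym (powℤ-+ x n (m ℕ.* n))))

  geometric : ∀ y n → (+ 1 - y) * sumℤ n (powℤ y) ≡ + 1 - powℤ y n
  geometric y zero    = ℤ.*-zeroʳ (+ 1 - y)
  geometric y (suc n) = trans (ℤ.*-distribˡ-+ (+ 1 - y) (sumℤ n (powℤ y)) (powℤ y n))
    (trans (cong (λ z → z + (+ 1 - y) * powℤ y n) (geometric y n)) (ring y (powℤ y n)))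
    where
    ring : ∀ y q → + 1 - q + (+ 1 - y) * q ≡ + 1 - y * q
    ring = solve-∀

  module Congruence (p : ℕ) where

    infix 4 _≈_
    record _≈_ (a b : ℤ) : Set where
      constructor mod
      field p∣a-b : + p ∣ a - b
    open _≈_ public

    ≈-reflexive : ∀ {a b} → a ≡ b → a ≈ b
    ≈-reflexive {a} refl = mod (divides (+ 0) (ℤ.+-inverseʳ a))

    ≈-refl : ∀ {a} → a ≈ a
    ≈-refl = ≈-reflexive refl

    ≈-sym : ∀ {a b} → a ≈ b → b ≈ a
    ≈-sym {a} {b} (mod d) = mod (subst (+ p ∣_) (ring a b) (∣m⇒∣-m d))
      where
      ring : ∀ a b → - (a - b) ≡ b - a
      ring = solve-∀

    ≈-trans : ∀ {a b c} → a ≈ b → b ≈ c → a ≈ c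
    ≈-trans {a} {b} {c} (mod d) (mod e) = mod (subst (+ p ∣_) (ring a b c) (∣m∣n⇒∣m+n d e))
      where
      ring : ∀ a b c → a - b + (b - c) ≡ a - c
      ring = solve-∀

    ≈-setoid : Setoid _ _
    ≈-setoid = record
      { Carrier = ℤ ; _≈_ = _≈_
      ; isEquivalence = record { refl = ≈-refl ; sym = ≈-sym ; trans = ≈-trans } }

    +-cong : ∀ {a b c d} → a ≈ b → c ≈ d → a + c ≈ b + d
    +-cong {a} {b} {c} {d} (mod e) (mod f) = mod (subst (+ p ∣_) (ring a b c d) (∣m∣n⇒∣m+n e f))
      where
      ring : ∀ a b c d → a - b + (c - d) ≡ a + c - (b + d)
      ring = solve-∀

    *-cong : ∀ {a b c d} → a ≈ b → c ≈ d → a * c ≈ b * d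
    *-cong {a} {b} {c} {d} (mod e) (mod f) =
      mod (subst (+ p ∣_) (ring a b c d) (∣m∣n⇒∣m+n (∣m⇒∣m*n c e) (∣n⇒∣m*n b f)))
      where
      ring : ∀ a b c d → (a - b) * c + b * (c - d) ≡ a * c - b * d
      ring = solve-∀

    -‿cong : ∀ {a b} → a ≈ b → - a ≈ - b
    -‿cong {a} {b} (mod e) = mod (subst (+ p ∣_) (ring a b) (∣m⇒∣-m e))
      where
      ring : ∀ a b → - (a - b) ≡ - a - - b
      ring = solve-∀

    *-congˡ : ∀ a {b c} → b ≈ c → a * b ≈ a * c
    *-congˡ a = *-cong (≈-refl {a})

    *-congʳ : ∀ {a b} c → a ≈ b → a * c ≈ b * c
    *-congʳ c e = *-cong e (≈-refl {c})

    powℤ-cong : ∀ {a b} n → a ≈ b → powℤ a n ≈ powℤ b n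
    powℤ-cong zero    e = ≈-refl
    powℤ-cong (suc n) e = *-cong e (powℤ-cong n e)

    powℤ-≈1 : ∀ {a} n → a ≈ + 1 → powℤ a n ≈ + 1
    powℤ-≈1 n e = ≈-trans (powℤ-cong n e) (≈-reflexive (powℤ-1 n))

    sum-cong≈ : ∀ n {f g : ℕ → ℤ} → (∀ k → k < n → f k ≈ g k) → sumℤ n f ≈ sumℤ n g
    sum-cong≈ zero    e = ≈-refl
    sum-cong≈ (suc n) e = +-cong (sum-cong≈ n λ k k<n → e k (ℕ.m<n⇒m<1+n k<n)) (e n (ℕ.n<1+n n))

    *-≈0ˡ : ∀ {a} b → a ≈ + 0 → a * b ≈ + 0
    *-≈0ˡ b e = *-congʳ b e

    *-≈0ʳ : ∀ a {b} → b ≈ + 0 → a * b ≈ + 0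
    *-≈0ʳ a e = ≈-trans (*-congˡ a e) (≈-reflexive (ℤ.*-zeroʳ a))

    ≈-difference : ∀ {a b} → a - b ≈ + 0 → a ≈ b
    ≈-difference {a} {b} (mod d) = mod (subst (+ p ∣_) (ℤ.+-identityʳ (a - b)) d)

    p≈0 : + p ≈ + 0
    p≈0 = mod (divides (+ 1) (trans (ℤ.+-identityʳ (+ p)) (sym (ℤ.*-identityˡ (+ p)))))

  module PrimeModulus (p : ℕ) (p-prime : Prime p) where
    open Congruence p public
    open SetoidReasoning ≈-setoid

    0<p : 0 < p
    0<p = ℕ.>-nonZero⁻¹ p {{prime⇒nonZero p-prime}}

    ≈0-∣ : ∀ {a} → a ≈ + 0 → p ℕ.∣ ∣ a ∣
    ≈0-∣ {a} (mod d) = ∣⇒∣ᵤ (subst (+ p ∣_) (ℤ.+-identityʳ a) d)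

    ∣-≈0 : ∀ {a} → p ℕ.∣ ∣ a ∣ → a ≈ + 0
    ∣-≈0 {a} d = mod (subst (+ p ∣_) (sym (ℤ.+-identityʳ a)) (∣ᵤ⇒∣ d))

    *-≈0⇒≈0 : ∀ a b → ¬ (a ≈ + 0) → a * b ≈ + 0 → b ≈ + 0
    *-≈0⇒≈0 a b a≉0 ab≈0 with euclidsLemma ∣ a ∣ ∣ b ∣ p-prime (subst (p ℕ.∣_) (ℤ.abs-* a b) (≈0-∣ ab≈0))
    ... | inj₁ p∣a = ⊥-elim (a≉0 (∣-≈0 p∣a))
    ... | inj₂ p∣b = ∣-≈0 p∣b

    *-cancelˡ-≈ : ∀ a b c → ¬ (a ≈ + 0) → a * b ≈ a * c → b ≈ c
    *-cancelˡ-≈ a b c a≉0 (mod d) = ≈-difference (*-≈0⇒≈0 a (b - c) a≉0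
      (mod (subst (+ p ∣_) (ring a b c) d)))
      where
      ring : ∀ a b c → a * b - a * c ≡ a * (b - c) - + 0
      ring = solve-∀

    small≉0 : ∀ k → suc k < p → ¬ (+ suc k ≈ + 0)
    small≉0 k 1+k<p e = ℕ.<⇒≱ 1+k<p (ℕ.∣⇒≤ (≈0-∣ e))

    -- C(e+i,i) = (−1)ⁱ C(−e−1,i), and −e−1 ≡ r.
    binom-reflect : ∀ {e r} i → suc (e ℕ.+ r) ≡ p → i < p →
      binom (e ℕ.+ i) i ≈ powℤ (- + 1) i * binom r i
    binom-reflect {e} {r} zero _ _ = ≈-reflexive
      (trans (binom-n-0 (e ℕ.+ 0)) (sym (trans (ℤ.*-identityˡ (binom r 0)) (binom-n-0 r))))
    binom-reflect {e} {r} (suc i) e+r i<p = *-cancelˡ-≈ (+ suc i) _ _ (small≉0 i i<p) (begin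
      + suc i * binom (e ℕ.+ suc i) (suc i)
        ≡⟨ cong (λ m → + suc i * binom m (suc i)) (ℕ.+-suc e i) ⟩
      + suc i * binom (suc (e ℕ.+ i)) (suc i)
        ≡⟨ binom-suc-suc (e ℕ.+ i) i ⟩
      + suc (e ℕ.+ i) * binom (e ℕ.+ i) i
        -- Consecutive terms have ratios (e+i+1)/(i+1) and -(r-i)/(i+1), which agree because e+1+r =
        -- p; the denominator is a unit since i+1 < p.
        ≈⟨ *-cong negate (binom-reflect i e+r (ℕ.<-trans (ℕ.n<1+n i) i<p)) ⟩
      - (+ r - + i) * (powℤ (- + 1) i * binom r i)
        ≡⟨ ring₁ (+ r - + i) (powℤ (- + 1) i) (binom r i) ⟩
      - + 1 * powℤ (- + 1) i * ((+ r - + i) * binom r i)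
        ≡⟨ cong (- + 1 * powℤ (- + 1) i *_) (binom-suc-k r i) ⟨
      - + 1 * powℤ (- + 1) i * (+ suc i * binom r (suc i))
        ≡⟨ ring₂ (- + 1 * powℤ (- + 1) i) (+ suc i) (binom r (suc i)) ⟩
      + suc i * (powℤ (- + 1) (suc i) * binom r (suc i)) ∎)
      where
      ring₁ : ∀ x s b → - x * (s * b) ≡ - + 1 * s * (x * b)
      ring₁ = solve-∀
      ring₂ : ∀ x y z → x * (y * z) ≡ y * (x * z)
      ring₂ = solve-∀
      ring₃ : ∀ e i r → + 1 + (e + i) ≡ + 1 + (e + r) + - (r - i)
      ring₃ = solve-∀
      negate : + suc (e ℕ.+ i) ≈ - (+ r - + i)
      negate = begin
        + suc (e ℕ.+ i)                       ≡⟨ cong (λ z → + 1 + z) (ℤ.pos-+ e i) ⟩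
        + 1 + (+ e + + i)                     ≡⟨ ring₃ (+ e) (+ i) (+ r) ⟩
        + 1 + (+ e + + r) + - (+ r - + i)     ≡⟨ cong (λ z → + 1 + z + - (+ r - + i)) (ℤ.pos-+ e r) ⟨
        + suc (e ℕ.+ r) + - (+ r - + i)       ≡⟨ cong (λ z → + z + - (+ r - + i)) e+r ⟩
        + p + - (+ r - + i)                   ≈⟨ +-cong p≈0 (≈-refl { - (+ r - + i)}) ⟩
        + 0 + - (+ r - + i)                   ≡⟨ ℤ.+-identityˡ _ ⟩
        - (+ r - + i)                         ∎

    complement : ∀ {e} → e < p → suc (e ℕ.+ (p ∸ suc e)) ≡ p
    complement e<p = ℕ.m+[n∸m]≡n e<p

    -- Adding e and i in base p produces a carry. After reflection the coefficient is C(p-1-e,i)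
    -- with i > p-1-e.
    binom-≈0 : ∀ e i → e < p → i < p → p ≤ e ℕ.+ i → binom (e ℕ.+ i) i ≈ + 0
    binom-≈0 e i e<p i<p p≤e+i = begin
      binom (e ℕ.+ i) i                             ≈⟨ binom-reflect i (complement e<p) i<p ⟩
      powℤ (- + 1) i * binom (p ∸ suc e) i          ≡⟨ *-0ʳ (powℤ (- + 1) i) (binom-0 r<i) ⟩
      + 0                                           ∎
      where
      r<i : p ∸ suc e < i
      r<i = ℕ.+-cancelˡ-< e (p ∸ suc e) i (subst (_≤ e ℕ.+ i) (sym (complement e<p)) p≤e+i)

    -- A truncation of the series of (1-y)^(-e-1), whose exponent is r modulo p. Reflection makes it
    -- a finite binomial expansion; the reflected coefficients vanish beyond r, so any cut-off
    -- between r+1 and p gives the same sum.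
    negative-binomial : ∀ {e r} y N → suc (e ℕ.+ r) ≡ p → r < N → N ≤ p →
      sumℤ N (λ i → binom (e ℕ.+ i) i * powℤ y i) ≈ powℤ (+ 1 - y) r
    negative-binomial {e} {r} y N e+r r<N N≤p = begin
      sumℤ N (λ i → binom (e ℕ.+ i) i * powℤ y i)
        ≈⟨ sum-cong≈ N (λ i i<N → begin
             binom (e ℕ.+ i) i * powℤ y i
               ≈⟨ *-congʳ (powℤ y i) (binom-reflect i e+r (ℕ.<-≤-trans i<N N≤p)) ⟩
             powℤ (- + 1) i * binom r i * powℤ y i
               ≡⟨ ring (powℤ (- + 1) i) (binom r i) (powℤ y i) ⟩
             binom r i * (powℤ (- + 1) i * powℤ y i)
               ≡⟨ cong (binom r i *_) (powℤ-distrib-* (- + 1) y i) ⟨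
             binom r i * powℤ (- + 1 * y) i
               ≡⟨ cong (λ z → binom r i * powℤ z i) (ℤ.-1*i≡-i y) ⟩
             binom r i * powℤ (- y) i ∎) ⟩
      sumℤ N (λ i → binom r i * powℤ (- y) i)
        ≡⟨ binomial-theorem r (- y) N r<N ⟩
      powℤ (+ 1 - y) r ∎
      where
      ring : ∀ s b y → s * b * y ≡ b * (s * y)
      ring = solve-∀

    q : ℕ
    q = p ∸ 1

    1+q≡p : suc q ≡ p
    1+q≡p = complement 0<p

    q<p : q < p
    q<p = subst (q <_) 1+q≡p (ℕ.n<1+n q)

    sum-powers : ∀ y → sumℤ p (powℤ y) ≈ powℤ (+ 1 - y) q
    sum-powers y = begin
      sumℤ p (powℤ y)
        ≡⟨ sum-cong p (λ i → trans (cong (_* powℤ y i) (binom-n-n i)) (ℤ.*-identityˡ (powℤ y i))) ⟨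
      sumℤ p (λ i → binom i i * powℤ y i)
        ≈⟨ negative-binomial {0} {q} y p 1+q≡p q<p ℕ.≤-refl ⟩
      powℤ (+ 1 - y) q ∎

    -- The geometric sum is (1-y)^(p-1) modulo p, and its product with 1-y is known exactly.
    freshman : ∀ y → powℤ (+ 1 - y) p ≈ + 1 - powℤ y p
    freshman y = begin
      powℤ (+ 1 - y) p                      ≡⟨ cong (powℤ (+ 1 - y)) 1+q≡p ⟨
      (+ 1 - y) * powℤ (+ 1 - y) q          ≈⟨ *-congˡ (+ 1 - y) (sum-powers y) ⟨
      (+ 1 - y) * sumℤ p (powℤ y)           ≡⟨ geometric y p ⟩
      + 1 - powℤ y p                        ∎

    -- Reflecting C(p-1,p-1) = 1 yields the sign for every prime, 2 included.
    [-1]^q : powℤ (- + 1) q ≈ + 1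
    [-1]^q = begin
      powℤ (- + 1) q                  ≡⟨ ℤ.*-identityʳ _ ⟨
      powℤ (- + 1) q * + 1            ≡⟨ cong (powℤ (- + 1) q *_) (binom-n-n q) ⟨
      powℤ (- + 1) q * binom q q      ≈⟨ binom-reflect {0} q 1+q≡p q<p ⟨
      binom q q                       ≡⟨ binom-n-n q ⟩
      + 1                             ∎

    powℤ-neg : ∀ y → powℤ (- y) p ≈ - powℤ y p
    powℤ-neg y = begin
      powℤ (- y) p                              ≡⟨ cong (λ z → powℤ z p) (ℤ.-1*i≡-i y) ⟨
      powℤ (- + 1 * y) p                        ≡⟨ powℤ-distrib-* (- + 1) y p ⟩
      powℤ (- + 1) p * powℤ y p                 ≡⟨ cong (λ m → powℤ (- + 1) m * powℤ y p) 1+q≡p ⟨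
      - + 1 * powℤ (- + 1) q * powℤ y p         ≈⟨ *-congʳ (powℤ y p) (*-congˡ (- + 1) [-1]^q) ⟩
      - + 1 * powℤ y p                          ≡⟨ ℤ.-1*i≡-i (powℤ y p) ⟩
      - powℤ y p                                ∎

    fermat-ℕ : ∀ n → powℤ (+ n) p ≈ + n
    fermat-ℕ zero = ≈-reflexive (cong (powℤ (+ 0)) (sym 1+q≡p))
    fermat-ℕ (suc n) = begin
      powℤ (+ suc n) p           ≡⟨ cong (λ z → powℤ (+ 1 + z) p) (ℤ.neg-involutive (+ n)) ⟨
      powℤ (+ 1 - - + n) p       ≈⟨ freshman (- + n) ⟩
      + 1 - powℤ (- + n) p       ≈⟨ +-cong (≈-refl {+ 1}) (-‿cong (powℤ-neg (+ n))) ⟩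
      + 1 - - powℤ (+ n) p       ≡⟨ cong (λ z → + 1 + z) (ℤ.neg-involutive (powℤ (+ n) p)) ⟩
      + 1 + powℤ (+ n) p         ≈⟨ +-cong (≈-refl {+ 1}) (fermat-ℕ n) ⟩
      + 1 + + n                  ∎

    fermat : ∀ a → powℤ a p ≈ a
    fermat (+ n)    = fermat-ℕ n
    fermat -[1+ n ] = ≈-trans (powℤ-neg (+ suc n)) (-‿cong (fermat-ℕ (suc n)))

    fermat-unit : ∀ a w → w * a ≈ + 1 → powℤ a q ≈ + 1
    fermat-unit a w wa≈1 = begin
      powℤ a q               ≡⟨ ℤ.*-identityˡ _ ⟨
      + 1 * powℤ a q         ≈⟨ *-congʳ (powℤ a q) wa≈1 ⟨
      w * a * powℤ a q       ≡⟨ ℤ.*-assoc w a (powℤ a q) ⟩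
      w * powℤ a (suc q)     ≡⟨ cong (λ m → w * powℤ a m) 1+q≡p ⟩
      w * powℤ a p           ≈⟨ *-congˡ w (fermat a) ⟩
      w * a                  ≈⟨ wa≈1 ⟩
      + 1                    ∎

    -- By Fermat a^(e+r) ≡ 1. This turns the exponents p-1-e produced by reflection into powers of
    -- an inverse.
    powℤ-inverse : ∀ {e r} a w → suc (e ℕ.+ r) ≡ p → w * a ≈ + 1 → powℤ a r ≈ powℤ w e
    powℤ-inverse {e} {r} a w e+r wa≈1 = begin
      powℤ a r                                ≡⟨ ℤ.*-identityˡ _ ⟨
      + 1 * powℤ a r                          ≈⟨ *-congʳ (powℤ a r) (powℤ-≈1 e wa≈1) ⟨
      powℤ (w * a) e * powℤ a r               ≡⟨ cong (_* powℤ a r) (powℤ-distrib-* w a e) ⟩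
      powℤ w e * powℤ a e * powℤ a r          ≡⟨ ℤ.*-assoc (powℤ w e) (powℤ a e) (powℤ a r) ⟩
      powℤ w e * (powℤ a e * powℤ a r)        ≡⟨ cong (powℤ w e *_) (powℤ-+ a e r) ⟨
      powℤ w e * powℤ a (e ℕ.+ r)             ≡⟨ cong (λ m → powℤ w e * powℤ a m) (ℕ.suc-injective (trans e+r (sym 1+q≡p))) ⟩
      powℤ w e * powℤ a q                     ≈⟨ *-congˡ (powℤ w e) (fermat-unit a w wa≈1) ⟩
      powℤ w e * + 1                          ≡⟨ ℤ.*-identityʳ _ ⟩
      powℤ w e                                ∎

    inverse : ℤ → ℤ
    inverse a = powℤ a (p ∸ 2)

    inverse-* : ∀ a → ¬ (a ≈ + 0) → inverse a * a ≈ + 1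
    inverse-* a a≉0 = *-cancelˡ-≈ a (inverse a * a) (+ 1) a≉0 (begin
      a * (inverse a * a)       ≡⟨ cong (a *_) (ℤ.*-comm (inverse a) a) ⟩
      powℤ a (2 ℕ.+ (p ∸ 2))    ≡⟨ cong (powℤ a) (ℕ.m+[n∸m]≡n 2≤p) ⟩
      powℤ a p                  ≈⟨ fermat a ⟩
      a                         ≡⟨ ℤ.*-identityʳ a ⟨
      a * + 1                   ∎)
      where
      2≤p : 2 ≤ p
      2≤p = ℕ.nonTrivial⇒n>1 p {{prime⇒nonTrivial p-prime}}

    -- Substitutions in sums over k < p

    binomial-transform-sum : ∀ (b : ℕ → ℤ) x v → v * (+ 1 - x) ≈ + 1 →
      sumℤ p (λ n → sumℤ (suc n) (λ k → binom n k * b k) * powℤ x n) ≈ sumℤ p (λ k → b k * powℤ (x * v) k)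
    binomial-transform-sum b x v v-inverse = begin
      sumℤ p (λ n → sumℤ (suc n) (λ k → binom n k * b k) * powℤ x n)
        ≡⟨ sum-cong< p expand ⟩
      sumℤ p (λ n → sumℤ p (λ k → term n k))
        ≡⟨ sum-swap p p term ⟩
      sumℤ p (λ k → sumℤ p (λ n → term n k))
        ≈⟨ sum-cong≈ p collect ⟩
      sumℤ p (λ k → b k * powℤ (x * v) k) ∎
      where
      term : ℕ → ℕ → ℤ
      term n k = binom n k * b k * powℤ x n

      expand : ∀ n → n < p → sumℤ (suc n) (λ k → binom n k * b k) * powℤ x n ≡ sumℤ p (λ k → term n k)
      expand n n<p = trans
        (cong (_* powℤ x n) (sym (sum-truncate (suc n) p _ n<p λ k n<k → *-0ˡ (b k) (binom-0 n<k))))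
        (sum-* p (powℤ x n) _)

      regroup : ∀ β b x y → β * b * (x * y) ≡ b * x * (β * y)
      regroup = solve-∀

      collect : ∀ k → k < p → sumℤ p (λ n → term n k) ≈ b k * powℤ (x * v) k
      collect k k<p = begin
        sumℤ p (λ n → term n k)
          ≡⟨ cong (λ m → sumℤ m (λ n → term n k)) (trans (ℕ.+-suc k r) (complement k<p)) ⟨
        sumℤ (k ℕ.+ suc r) (λ n → term n k)
          ≡⟨ sum-skip k (suc r) (λ n → term n k) (λ n n<k → *-0ˡ (powℤ x n) (*-0ˡ (b k) (binom-0 n<k))) ⟩
        sumℤ (suc r) (λ i → term (k ℕ.+ i) k)
          ≡⟨ sum-cong (suc r) (λ i → trans
               (cong₂ (λ β y → β * b k * y) (binom-sym k i) (powℤ-+ x k i))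
               (regroup (binom (k ℕ.+ i) i) (b k) (powℤ x k) (powℤ x i))) ⟩
        sumℤ (suc r) (λ i → b k * powℤ x k * (binom (k ℕ.+ i) i * powℤ x i))
          ≡⟨ *-sum (suc r) (b k * powℤ x k) _ ⟨
        b k * powℤ x k * sumℤ (suc r) (λ i → binom (k ℕ.+ i) i * powℤ x i)
          -- The inner sum is (1-x)^(p-1-k), and `v` inverts 1-x, so it becomes v^k.
          ≈⟨ *-congˡ (b k * powℤ x k) (≈-trans
               (negative-binomial {k} {r} x (suc r) (complement k<p) (ℕ.n<1+n r)
                 (subst (suc r ≤_) (complement k<p) (s≤s (ℕ.m≤n+m r k))))
               (powℤ-inverse {k} {r} (+ 1 - x) v (complement k<p) v-inverse)) ⟩
        b k * powℤ x k * powℤ v k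
          ≡⟨ trans (ℤ.*-assoc (b k) (powℤ x k) (powℤ v k)) (cong (b k *_) (sym (powℤ-distrib-* x v k))) ⟩
        b k * powℤ (x * v) k ∎
        where r = p ∸ suc k

    -- In (3j)!/j!³ the prime divides the numerator only. In terms of the two factors of `c`, a
    -- carry occurs either in j+j or in 2j+j.
    c-≈0 : ∀ j → j < p → p ≤ 3 ℕ.* j → c j ≈ + 0
    c-≈0 j j<p p≤3j with p ℕ.≤? 2 ℕ.* j
    ... | yes p≤2j = *-≈0ˡ (binom (3 ℕ.* j) j)
      (subst (λ m → binom m j ≈ + 0) (cong (j ℕ.+_) (sym (ℕ.+-identityʳ j)))
        (binom-≈0 j j j<p j<p (subst (p ≤_) (cong (j ℕ.+_) (ℕ.+-identityʳ j)) p≤2j)))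
    ... | no p≰2j = *-≈0ʳ (binom (2 ℕ.* j) j)
      (subst (λ m → binom m j ≈ + 0) (ℕ.+-comm (2 ℕ.* j) j)
        (binom-≈0 (2 ℕ.* j) j (ℕ.≰⇒> p≰2j) j<p (subst (p ≤_) (ℕ.+-comm j (2 ℕ.* j)) p≤3j)))

    cSum : ℤ → ℤ
    cSum z = sumℤ p (λ j → c j * powℤ z j)

    franelSum : ℤ → ℤ
    franelSum x = sumℤ p (λ k → fr k * powℤ x k)

    -- For fixed j, writing k = 2j+i in MacMahon's formula leaves c_j x^(2j) Σ_i C(3j+i,i) (2x)ⁱ, a
    -- negative binomial sum equal to (1-2x)^(p-1-3j) ≡ w^(3j). This exponent exists only for 3j <
    -- p, which is why the other j are treated apart.
    franelSum-cSum : ∀ x w → w * (+ 1 - + 2 * x) ≈ + 1 → franelSum x ≈ cSum (powℤ x 2 * powℤ w 3)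
    franelSum-cSum x w w-inverse = begin
      franelSum x
        ≡⟨ sum-cong< p expand ⟩
      sumℤ p (λ k → sumℤ p (λ j → term k j))
        ≡⟨ sum-swap p p term ⟩
      sumℤ p (λ j → sumℤ p (λ k → term k j))
        ≈⟨ sum-cong≈ p collect ⟩
      cSum (powℤ x 2 * powℤ w 3) ∎
      where
      term : ℕ → ℕ → ℤ
      term k j = t k j * powℤ x k

      expand : ∀ k → k < p → fr k * powℤ x k ≡ sumℤ p (λ j → term k j)
      expand k k<p = trans
        (cong (_* powℤ x k) (trans (macmahon k) (sym (sum-truncate (suc k) p (t k) k<p λ j k<j →
          *-0ˡ (powℤ (+ 2) (k ∸ 2 ℕ.* j)) (u-0 (ℕ.<-≤-trans k<j (ℕ.m≤m+n j (j ℕ.+ 0))))))))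
        (sum-* p (powℤ x k) _)

      regroup : ∀ β c w y z → β * c * w * (y * z) ≡ c * y * (β * (w * z))
      regroup = solve-∀

      shifted : ∀ j i → 2 ℕ.* j ℕ.+ i ℕ.+ j ≡ 3 ℕ.* j ℕ.+ i
      shifted = ℕSolver.solve-∀

      collect : ∀ j → j < p → sumℤ p (λ k → term k j) ≈ c j * powℤ (powℤ x 2 * powℤ w 3) j
      collect j j<p with p ℕ.≤? 3 ℕ.* j
      ... | yes p≤3j = begin
        sumℤ p (λ k → term k j)
          ≈⟨ sum-cong≈ p (λ k _ → *-≈0ˡ (powℤ x k) (*-≈0ˡ (powℤ (+ 2) (k ∸ 2 ℕ.* j))
               (*-≈0ʳ (binom (k ℕ.+ j) (3 ℕ.* j)) (c-≈0 j j<p p≤3j)))) ⟩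
        sumℤ p (λ _ → + 0)
          ≡⟨ sum-0 p (λ _ _ → refl) ⟩
        + 0
          ≈⟨ *-≈0ˡ (powℤ (powℤ x 2 * powℤ w 3) j) (c-≈0 j j<p p≤3j) ⟨
        c j * powℤ (powℤ x 2 * powℤ w 3) j ∎
      ... | no p≰3j = begin
        sumℤ p (λ k → term k j)
          ≡⟨ cong (λ m → sumℤ m (λ k → term k j)) (ℕ.m+[n∸m]≡n 2j≤p) ⟨
        sumℤ (2 ℕ.* j ℕ.+ (p ∸ 2 ℕ.* j)) (λ k → term k j)
          ≡⟨ sum-skip (2 ℕ.* j) (p ∸ 2 ℕ.* j) (λ k → term k j) (λ k k<2j →
               *-0ˡ (powℤ x k) (*-0ˡ (powℤ (+ 2) (k ∸ 2 ℕ.* j)) (u-0 k<2j))) ⟩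
        sumℤ (p ∸ 2 ℕ.* j) (λ i → term (2 ℕ.* j ℕ.+ i) j)
          ≡⟨ sum-cong (p ∸ 2 ℕ.* j) reindex ⟩
        sumℤ (p ∸ 2 ℕ.* j) (λ i → c j * powℤ x (2 ℕ.* j) * (binom (3 ℕ.* j ℕ.+ i) i * powℤ (+ 2 * x) i))
          ≡⟨ *-sum (p ∸ 2 ℕ.* j) (c j * powℤ x (2 ℕ.* j)) _ ⟨
        c j * powℤ x (2 ℕ.* j) * sumℤ (p ∸ 2 ℕ.* j) (λ i → binom (3 ℕ.* j ℕ.+ i) i * powℤ (+ 2 * x) i)
          ≈⟨ *-congˡ (c j * powℤ x (2 ℕ.* j)) (≈-trans
               -- The range i < p-2j, forced by k < p, reaches beyond the degree p-1-3j.
               (negative-binomial {3 ℕ.* j} {p ∸ suc (3 ℕ.* j)} (+ 2 * x) (p ∸ 2 ℕ.* j) (complement 3j<p)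
                 (ℕ.∸-monoʳ-< (s≤s 2j≤3j) 3j<p) (ℕ.m∸n≤m p (2 ℕ.* j)))
               (powℤ-inverse {3 ℕ.* j} {p ∸ suc (3 ℕ.* j)} (+ 1 - + 2 * x) w (complement 3j<p) w-inverse)) ⟩
        c j * powℤ x (2 ℕ.* j) * powℤ w (3 ℕ.* j)
          ≡⟨ trans (ℤ.*-assoc (c j) (powℤ x (2 ℕ.* j)) (powℤ w (3 ℕ.* j)))
                   (cong (c j *_) (trans (cong₂ _*_ (sym (powℤ-powℤ x 2 j)) (sym (powℤ-powℤ w 3 j)))
                     (sym (powℤ-distrib-* (powℤ x 2) (powℤ w 3) j)))) ⟩
        c j * powℤ (powℤ x 2 * powℤ w 3) j ∎
        where
        3j<p = ℕ.≰⇒> p≰3j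
        2j≤3j : 2 ℕ.* j ≤ 3 ℕ.* j
        2j≤3j = ℕ.*-monoˡ-≤ j {2} {3} (s≤s (s≤s z≤n))
        2j≤p = ℕ.≤-trans 2j≤3j (ℕ.<⇒≤ 3j<p)
        reindex : ∀ i → term (2 ℕ.* j ℕ.+ i) j
          ≡ c j * powℤ x (2 ℕ.* j) * (binom (3 ℕ.* j ℕ.+ i) i * powℤ (+ 2 * x) i)
        reindex i = trans
          (cong₂ (λ β y → β * c j * powℤ (+ 2) (2 ℕ.* j ℕ.+ i ∸ 2 ℕ.* j) * y)
            (trans (cong (λ m → binom m (3 ℕ.* j)) (shifted j i)) (binom-sym (3 ℕ.* j) i))
            (powℤ-+ x (2 ℕ.* j) i))
          (trans (cong (λ m → binom (3 ℕ.* j ℕ.+ i) i * c j * powℤ (+ 2) m * (powℤ x (2 ℕ.* j) * powℤ x i))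
                       (ℕ.m+n∸m≡n (2 ℕ.* j) i))
            (trans (regroup (binom (3 ℕ.* j ℕ.+ i) i) (c j) (powℤ (+ 2) i) (powℤ x (2 ℕ.* j)) (powℤ x i))
              (cong (λ z → c j * powℤ x (2 ℕ.* j) * (binom (3 ℕ.* j ℕ.+ i) i * z))
                    (sym (powℤ-distrib-* (+ 2) x i)))))

    operator-cong : ∀ {n n' x x' y y' z z'} → n ≈ n' → x ≈ x' → y ≈ y' → z ≈ z' →
      franel-operator n x y z ≈ franel-operator n' x' y' z'
    operator-cong n≈ x≈ y≈ z≈ =
      +-cong (+-cong (*-cong (*-cong n+1≈ n+1≈) x≈)
                     (-‿cong (*-cong (+-cong (+-cong (*-cong (*-congˡ (+ 7) n≈) n≈) (*-congˡ (+ 7) n≈)) (≈-refl {+ 2})) y≈)))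
             (-‿cong (*-cong (*-cong (*-congˡ (+ 8) n≈) n≈) z≈))
      where n+1≈ = +-cong n≈ (≈-refl {+ 1})

    -- The reflection of Franel numbers under n ↦ p-1-n

    module OddModulus (p≢2 : p ≢ 2) where

      half : ℤ
      half = inverse (+ 2)

      half-inverse : half * + 2 ≈ + 1
      half-inverse = inverse-* (+ 2) λ 2≈0 → p≢2 (ℕ.≤-antisym (ℕ.∣⇒≤ (≈0-∣ 2≈0))
        (ℕ.nonTrivial⇒n>1 p {{prime⇒nonTrivial p-prime}}))

      -- As C(p-1,i) ≡ (-1)ⁱ, the sum of cubes is the geometric sum at -1, that is 2^(p-1), and 2 is
      -- a unit.
      franel-last : fr q ≈ + 1
      franel-last = begin
        fr q                                                         ≡⟨ franel-cubes q ⟩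
        sumℤ (suc q) (λ i → binom q i * binom q i * binom q i)
          ≡⟨ cong (λ m → sumℤ m (λ i → binom q i * binom q i * binom q i)) 1+q≡p ⟩
        sumℤ p (λ i → binom q i * binom q i * binom q i)             ≈⟨ sum-cong≈ p (λ i i<p → cube-sign i i<p) ⟩
        sumℤ p (powℤ (- + 1))                                        ≈⟨ sum-powers (- + 1) ⟩
        powℤ (+ 2) q                                                 ≈⟨ fermat-unit (+ 2) half half-inverse ⟩
        + 1                                                          ∎
        where
        ring : ∀ s b → b * b * b * (s * s) ≡ s * b * (s * b) * b
        ring = solve-∀
        ring₂ : ∀ s b → + 1 * + 1 * (s * s * b) ≡ s * (s * b)
        ring₂ = solve-∀
        cube-sign : ∀ i → i < p → binom q i * binom q i * binom q i ≈ powℤ (- + 1) i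
        cube-sign i i<p = begin
          b * b * b                     ≡⟨ ℤ.*-identityʳ _ ⟨
          b * b * b * + 1               ≡⟨ cong (b * b * b *_) s*s ⟨
          b * b * b * (s * s)           ≡⟨ ring s b ⟩
          s * b * (s * b) * b           ≈⟨ *-congʳ b (*-cong sb≈1 sb≈1) ⟩
          + 1 * + 1 * b                 ≡⟨ cong (λ z → + 1 * + 1 * z) (ℤ.*-identityˡ b) ⟨
          + 1 * + 1 * (+ 1 * b)         ≡⟨ cong (λ z → + 1 * + 1 * (z * b)) s*s ⟨
          + 1 * + 1 * (s * s * b)       ≡⟨ ring₂ s b ⟩
          s * (s * b)                   ≈⟨ *-congˡ s sb≈1 ⟩
          s * + 1                       ≡⟨ ℤ.*-identityʳ s ⟩
          s                             ∎
          where
          b = binom q i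
          s = powℤ (- + 1) i
          s*s : s * s ≡ + 1
          s*s = trans (sym (powℤ-distrib-* (- + 1) (- + 1) i)) (powℤ-1 i)
          sb≈1 : s * b ≈ + 1
          sb≈1 = ≈-trans (≈-sym (binom-reflect {0} {q} i 1+q≡p i<p)) (≈-reflexive (binom-n-n i))

      -- The sequence n ↦ (−8)ⁿ f_{p−1−n} satisfies Franel's recurrence modulo p.
      franel-reflect : ∀ n r → suc (n ℕ.+ r) ≡ p → fr n ≈ powℤ (- + 8) n * fr r
      franel-reflect zero r 1+r≡p = begin
        + 1              ≈⟨ franel-last ⟨
        fr q             ≡⟨ cong fr (ℕ.suc-injective (trans 1+q≡p (sym 1+r≡p))) ⟩
        fr r             ≡⟨ ℤ.*-identityˡ (fr r) ⟨
        + 1 * fr r       ∎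
      -- The recurrence at index p-1 ≡ -1: the coefficient of f_p vanishes and what remains is 2
      -- f_{p-1} + 8 f_{p-2} ≡ 0, where f_{p-1} ≡ 1 and f_1 = 2.
      franel-reflect (suc zero) r 2+r≡p = ≈-difference (begin
        + 2 - powℤ (- + 8) 1 * fr r
          ≡⟨ ring (fr (suc (suc r))) (fr r) ⟩
        - franel-operator (- + 1) (fr (suc (suc r))) (+ 1) (fr r)
          ≈⟨ -‿cong (operator-cong N≈-1 (≈-refl {fr (suc (suc r))}) last≈1 (≈-refl {fr r})) ⟨
        - franel-operator (+ suc r) (fr (suc (suc r))) (fr (suc r)) (fr r)
          ≡⟨ cong -_ (franel-recurrence r) ⟩
        + 0 ∎)
        where
        ring : ∀ x z → + 2 - (- + 8 * + 1) * z
          ≡ - ((- + 1 + + 1) * (- + 1 + + 1) * x - (+ 7 * - + 1 * - + 1 + + 7 * - + 1 + + 2) * + 1 - + 8 * - + 1 * - + 1 * z)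
        ring = solve-∀
        ring₂ : ∀ x → x ≡ + 1 + x - + 1
        ring₂ = solve-∀
        N≈-1 : + suc r ≈ - + 1
        N≈-1 = begin
          + suc r                    ≡⟨ ring₂ (+ suc r) ⟩
          + suc (suc r) - + 1        ≡⟨ cong (λ m → + m - + 1) 2+r≡p ⟩
          + p - + 1                  ≈⟨ +-cong p≈0 (≈-refl { - + 1}) ⟩
          - + 1                      ∎
        last≈1 : fr (suc r) ≈ + 1
        last≈1 = ≈-trans (≈-reflexive (cong fr (ℕ.suc-injective (trans 2+r≡p (sym 1+q≡p))))) franel-last
      franel-reflect (suc (suc n)) r n+r = ≈-difference (*-≈0⇒≈0 (+ suc (suc n)) _ 2+n≉0
        (*-≈0⇒≈0 (+ suc (suc n)) _ 2+n≉0 (begin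
          + suc (suc n) * (+ suc (suc n) * (fr (suc (suc n)) - powℤ (- + 8) (suc (suc n)) * fr r))
            -- With M = n+1, the recurrences at M and at r+1 ≡ -1-M are added with weights 1 and
            -- 8(-8)ⁿ. The f_{r+1} and f_{r+2} terms cancel, leaving (M+1)² times the claim; M+1 is
            -- a unit because n+2 < p.
            ≡⟨ combine (+ suc n) (fr (suc (suc n))) e (fr r) (fr (suc r)) (fr (suc (suc r))) ⟩
          franel-operator (+ suc n) (fr (suc (suc n))) (- + 8 * e * fr (suc r)) (e * fr (suc (suc r)))
            + + 8 * e * franel-operator (- (+ 1 + + suc n)) (fr (suc (suc r))) (fr (suc r)) (fr r)
            ≈⟨ +-cong (operator-cong (≈-refl {+ suc n}) (≈-refl {fr (suc (suc n))})
                        (franel-reflect (suc n) (suc r) (trans (cong (λ m → suc (suc m)) (ℕ.+-suc n r)) n+r))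
                        (franel-reflect n (suc (suc r))
                          (trans (cong suc (trans (ℕ.+-suc n (suc r)) (cong suc (ℕ.+-suc n r)))) n+r)))
                      (*-congˡ (+ 8 * e) (operator-cong N≈-M (≈-refl {fr (suc (suc r))}) (≈-refl {fr (suc r)}) (≈-refl {fr r}))) ⟨
          franel-operator (+ suc n) (fr (suc (suc n))) (fr (suc n)) (fr n)
            + + 8 * e * franel-operator (+ suc r) (fr (suc (suc r))) (fr (suc r)) (fr r)
            ≡⟨ cong₂ (λ x y → x + + 8 * e * y) (franel-recurrence n) (franel-recurrence r) ⟩
          + 0 + + 8 * e * + 0
            ≡⟨ trans (ℤ.+-identityˡ (+ 8 * e * + 0)) (ℤ.*-zeroʳ (+ 8 * e)) ⟩
          + 0 ∎)))
        where
        e = powℤ (- + 8) n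
        combine : ∀ M X e F₀ F₁ F₂ → (+ 1 + M) * ((+ 1 + M) * (X - - + 8 * (- + 8 * e) * F₀))
          ≡ ((M + + 1) * (M + + 1) * X - (+ 7 * M * M + + 7 * M + + 2) * (- + 8 * e * F₁) - + 8 * M * M * (e * F₂))
            + + 8 * e * ((- (+ 1 + M) + + 1) * (- (+ 1 + M) + + 1) * F₂
              - (+ 7 * - (+ 1 + M) * - (+ 1 + M) + + 7 * - (+ 1 + M) + + 2) * F₁
              - + 8 * - (+ 1 + M) * - (+ 1 + M) * F₀)
        combine = solve-∀
        2+n<p : suc (suc n) < p
        2+n<p = subst (suc (suc n) <_) n+r (s≤s (ℕ.m≤m+n (suc (suc n)) r))
        2+n≉0 = small≉0 (suc n) 2+n<p
        ring : ∀ n r → + 1 + r ≡ + 1 + (+ 1 + (+ 1 + (n + r))) + - (+ 1 + (+ 1 + n))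
        ring = solve-∀
        N≈-M : + suc r ≈ - (+ 1 + + suc n)
        N≈-M = begin
          + suc r
            ≡⟨ ring (+ n) (+ r) ⟩
          + 1 + (+ 1 + (+ 1 + (+ n + + r))) + - (+ 1 + + suc n)
            ≡⟨ cong (λ z → z + - (+ 1 + + suc n))
                    (trans (cong (λ z → + 1 + (+ 1 + (+ 1 + z))) (sym (ℤ.pos-+ n r))) (cong +_ n+r)) ⟩
          + p + - (+ 1 + + suc n)
            ≈⟨ +-cong p≈0 (≈-refl { - (+ 1 + + suc n)}) ⟩
          + 0 + - (+ 1 + + suc n)
            ≡⟨ ℤ.+-identityˡ (- (+ 1 + + suc n)) ⟩
          - (+ 1 + + suc n) ∎

      -- Under k ↦ p-1-k the summand becomes f_k (-8x)^(p-1-k), and the complementary power of -8x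
      -- is a power of its inverse y.
      franelSum-reflect : ∀ x y → y * (- + 8 * x) ≈ + 1 → franelSum x ≈ franelSum y
      franelSum-reflect x y y-inverse = begin
        franelSum x
          ≡⟨ sum-reverse p _ ⟩
        sumℤ p (λ k → fr (p ∸ suc k) * powℤ x (p ∸ suc k))
          ≈⟨ sum-cong≈ p term ⟩
        franelSum y ∎
        where
        regroup : ∀ a b c → a * b * c ≡ b * (a * c)
        regroup = solve-∀
        term : ∀ k → k < p → fr (p ∸ suc k) * powℤ x (p ∸ suc k) ≈ fr k * powℤ y k
        term k k<p = begin
          fr r * powℤ x r
            ≈⟨ *-congʳ (powℤ x r) (franel-reflect r k (trans (cong suc (ℕ.+-comm r k)) (complement k<p))) ⟩
          powℤ (- + 8) r * fr k * powℤ x r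
            ≡⟨ regroup (powℤ (- + 8) r) (fr k) (powℤ x r) ⟩
          fr k * (powℤ (- + 8) r * powℤ x r)
            ≡⟨ cong (fr k *_) (powℤ-distrib-* (- + 8) x r) ⟨
          fr k * powℤ (- + 8 * x) r
            ≈⟨ *-congˡ (fr k) (powℤ-inverse {k} {r} (- + 8 * x) y (complement k<p) y-inverse) ⟩
          fr k * powℤ y k ∎
          where r = p ∸ suc k

      -- The sums of a_k and Q_k expressed through c_j

      aSum : ℤ → ℤ
      aSum x = sumℤ p (λ k → + aSeq k * powℤ x k)

      QSum : ℤ → ℤ
      QSum x = sumℤ p (λ k → QSeq k * powℤ x k)

      -- With g ≡ -1/8, (-8)^(n-k) gⁿ ≡ gᵏ: after scaling, Q_n is the plain binomial transform of
      -- f_k gᵏ.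
      QSeq-scaled : ∀ g n → g * - + 8 ≈ + 1 →
        QSeq n * powℤ g n ≈ sumℤ (suc n) (λ k → binom n k * (fr k * powℤ g k))
      QSeq-scaled g n g-inverse = begin
        QSeq n * powℤ g n
          ≡⟨ sum-* (suc n) (powℤ g n) _ ⟩
        sumℤ (suc n) (λ k → + (n C k) * powℤ (- + 8) (n ∸ k) * fr k * powℤ g n)
          ≈⟨ sum-cong≈ (suc n) (λ k k<1+n → term k (ℕ.s≤s⁻¹ k<1+n)) ⟩
        sumℤ (suc n) (λ k → binom n k * (fr k * powℤ g k)) ∎
        where
        regroup : ∀ a b c d e → a * b * c * (d * e) ≡ d * b * (a * (c * e))
        regroup = solve-∀
        term : ∀ k → k ≤ n → + (n C k) * powℤ (- + 8) (n ∸ k) * fr k * powℤ g n ≈ binom n k * (fr k * powℤ g k)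
        term k k≤n = begin
          + (n C k) * powℤ (- + 8) (n ∸ k) * fr k * powℤ g n
            ≡⟨ cong₂ (λ b m → b * powℤ (- + 8) (n ∸ k) * fr k * powℤ g m) (binom-C n k) (sym (ℕ.m∸n+n≡m k≤n)) ⟩
          binom n k * powℤ (- + 8) (n ∸ k) * fr k * powℤ g (n ∸ k ℕ.+ k)
            ≡⟨ cong (binom n k * powℤ (- + 8) (n ∸ k) * fr k *_) (powℤ-+ g (n ∸ k) k) ⟩
          binom n k * powℤ (- + 8) (n ∸ k) * fr k * (powℤ g (n ∸ k) * powℤ g k)
            ≡⟨ regroup (binom n k) (powℤ (- + 8) (n ∸ k)) (fr k) (powℤ g (n ∸ k)) (powℤ g k) ⟩
          powℤ g (n ∸ k) * powℤ (- + 8) (n ∸ k) * (binom n k * (fr k * powℤ g k))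
            ≡⟨ cong (_* (binom n k * (fr k * powℤ g k))) (powℤ-distrib-* g (- + 8) (n ∸ k)) ⟨
          powℤ (g * - + 8) (n ∸ k) * (binom n k * (fr k * powℤ g k))
            ≈⟨ *-congʳ (binom n k * (fr k * powℤ g k)) (powℤ-≈1 (n ∸ k) g-inverse) ⟩
          + 1 * (binom n k * (fr k * powℤ g k))
            ≡⟨ ℤ.*-identityˡ _ ⟩
          binom n k * (fr k * powℤ g k) ∎

      module _ (M n s : ℤ) (n-inverse : n * M ≈ + 1) (s-inverse : s * (M - + 1) ≈ + 1) where

        private
          -- In the transform x = 1/m, so the inverse of 1-x is m/(m-1), represented by `M * s`; the
          -- new argument is their product 1/(m-1).
          v-inverse : M * s * (+ 1 - n) ≈ + 1
          v-inverse = begin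
            M * s * (+ 1 - n)          ≡⟨ ring₁ M s n ⟩
            s * M - n * M * s          ≈⟨ +-cong (≈-refl {s * M}) (-‿cong (*-congʳ s n-inverse)) ⟩
            s * M - + 1 * s            ≡⟨ ring₂ M s ⟩
            s * (M - + 1)              ≈⟨ s-inverse ⟩
            + 1                        ∎
            where
            ring₁ : ∀ M s n → M * s * (+ 1 - n) ≡ s * M - n * M * s
            ring₁ = solve-∀
            ring₂ : ∀ M s → s * M - + 1 * s ≡ s * (M - + 1)
            ring₂ = solve-∀

          nv≈s : n * (M * s) ≈ s
          nv≈s = begin
            n * (M * s)      ≡⟨ ℤ.*-assoc n M s ⟨
            n * M * s        ≈⟨ *-congʳ s n-inverse ⟩
            + 1 * s          ≡⟨ ℤ.*-identityˡ s ⟩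
            s                ∎

        aSum-franelSum : aSum n ≈ franelSum s
        aSum-franelSum = begin
          aSum n
            ≡⟨ sum-cong p (λ k → cong (_* powℤ n k) (barrucand k)) ⟩
          sumℤ p (λ k → sumℤ (suc k) (λ i → binom k i * fr i) * powℤ n k)
            ≈⟨ binomial-transform-sum fr n (M * s) v-inverse ⟩
          franelSum (n * (M * s))
            ≈⟨ sum-cong≈ p (λ k _ → *-congˡ (fr k) (powℤ-cong k nv≈s)) ⟩
          franelSum s ∎

        QSum-franelSum : ∀ g → g * - + 8 ≈ + 1 → QSum (g * n) ≈ franelSum (g * s)
        QSum-franelSum g g-inverse = begin
          QSum (g * n)
            ≡⟨ sum-cong p (λ k → trans (cong (QSeq k *_) (powℤ-distrib-* g n k))
                                       (sym (ℤ.*-assoc (QSeq k) (powℤ g k) (powℤ n k)))) ⟩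
          sumℤ p (λ k → QSeq k * powℤ g k * powℤ n k)
            ≈⟨ sum-cong≈ p (λ k _ → *-congʳ (powℤ n k) (QSeq-scaled g k g-inverse)) ⟩
          sumℤ p (λ k → sumℤ (suc k) (λ i → binom k i * (fr i * powℤ g i)) * powℤ n k)
            ≈⟨ binomial-transform-sum (λ i → fr i * powℤ g i) n (M * s) v-inverse ⟩
          sumℤ p (λ k → fr k * powℤ g k * powℤ (n * (M * s)) k)
            ≈⟨ sum-cong≈ p (λ k _ → *-congˡ (fr k * powℤ g k) (powℤ-cong k nv≈s)) ⟩
          sumℤ p (λ k → fr k * powℤ g k * powℤ s k)
            ≡⟨ sum-cong p (λ k → trans (ℤ.*-assoc (fr k) (powℤ g k) (powℤ s k))
                                       (cong (fr k *_) (sym (powℤ-distrib-* g s k)))) ⟩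
          franelSum (g * s) ∎

        cSum-cong : ∀ {x y} → x ≈ y → cSum x ≈ cSum y
        cSum-cong x≈y = sum-cong≈ p λ k _ → *-congˡ (c k) (powℤ-cong k x≈y)

        -- At x = 1/(m-1), 1-2x = (m-3)/(m-1), and x²/(1-2x)³ = (m-1)/(m-3)³.
        aSum-cSum₁ : ∀ r → r * (M - + 3) ≈ + 1 → aSum n ≈ cSum ((M - + 1) * powℤ r 3)
        aSum-cSum₁ r r-inverse = begin
          aSum n
            ≈⟨ aSum-franelSum ⟩
          franelSum s
            ≈⟨ franelSum-cSum s ((M - + 1) * r) w-inverse ⟩
          cSum (powℤ s 2 * powℤ ((M - + 1) * r) 3)
            ≈⟨ cSum-cong (begin
                 powℤ s 2 * powℤ ((M - + 1) * r) 3                           ≡⟨ ring₃ M s r ⟩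
                 powℤ (s * (M - + 1)) 2 * ((M - + 1) * powℤ r 3)             ≈⟨ *-congʳ _ (powℤ-≈1 2 s-inverse) ⟩
                 + 1 * ((M - + 1) * powℤ r 3)                                ≡⟨ ℤ.*-identityˡ _ ⟩
                 (M - + 1) * powℤ r 3                                        ∎) ⟩
          cSum ((M - + 1) * powℤ r 3) ∎
          where
          ring₁ : ∀ M s r → (M - + 1) * r * (+ 1 - + 2 * s) ≡ r * (M - + 1 - + 2 * (s * (M - + 1)))
          ring₁ = solve-∀
          ring₂ : ∀ M r → r * (M - + 1 - + 2 * + 1) ≡ r * (M - + 3)
          ring₂ = solve-∀
          ring₃ : ∀ M s r →
            s * (s * + 1) * ((M - + 1) * r * ((M - + 1) * r * ((M - + 1) * r * + 1)))
            ≡ s * (M - + 1) * (s * (M - + 1) * + 1) * ((M - + 1) * (r * (r * (r * + 1))))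
          ring₃ = solve-∀
          w-inverse : (M - + 1) * r * (+ 1 - + 2 * s) ≈ + 1
          w-inverse = begin
            (M - + 1) * r * (+ 1 - + 2 * s)                ≡⟨ ring₁ M s r ⟩
            r * (M - + 1 - + 2 * (s * (M - + 1)))
              ≈⟨ *-congˡ r (+-cong (≈-refl {M - + 1}) (-‿cong (*-congˡ (+ 2) s-inverse))) ⟩
            r * (M - + 1 - + 2 * + 1)                      ≡⟨ ring₂ M r ⟩
            r * (M - + 3)                                  ≈⟨ r-inverse ⟩
            + 1                                            ∎

        aSum-cSum₂ : ∀ r → r * (M + + 3) ≈ + 1 → aSum n ≈ cSum (powℤ (M - + 1) 2 * powℤ r 3)
        aSum-cSum₂ r r-inverse = begin
          aSum n
            ≈⟨ aSum-franelSum ⟩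
          franelSum s
            ≈⟨ franelSum-reflect s y y-inverse ⟩
          franelSum y
            ≈⟨ franelSum-cSum y (+ 4 * r) w-inverse ⟩
          cSum (powℤ y 2 * powℤ (+ 4 * r) 3)
            ≈⟨ cSum-cong (begin
                 powℤ y 2 * powℤ (+ 4 * r) 3                                ≡⟨ ring₄ M half r ⟩
                 powℤ (half * + 2) 6 * (powℤ (M - + 1) 2 * powℤ r 3)        ≈⟨ *-congʳ _ (powℤ-≈1 6 half-inverse) ⟩
                 + 1 * (powℤ (M - + 1) 2 * powℤ r 3)                        ≡⟨ ℤ.*-identityˡ _ ⟩
                 powℤ (M - + 1) 2 * powℤ r 3                                ∎) ⟩
          cSum (powℤ (M - + 1) 2 * powℤ r 3) ∎
          where
          -- The reflected point -1/(8s) is -(m-1)/8. There 1-2y = (m+3)/4, whence the inverse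
          -- `+ 4 * r`, and the 64 from y² cancels against 4³.
          y = - (M - + 1) * powℤ half 3
          ring₁ : ∀ M h s → - (M - + 1) * (h * (h * (h * + 1))) * (- + 8 * s)
            ≡ h * + 2 * (h * + 2 * (h * + 2 * + 1)) * (s * (M - + 1))
          ring₁ = solve-∀
          ring₂ : ∀ M h r → + 4 * r * (+ 1 - + 2 * (- (M - + 1) * (h * (h * (h * + 1)))))
            ≡ + 4 * r + h * + 2 * (h * + 2 * (h * + 2 * + 1)) * (r * (M - + 1))
          ring₂ = solve-∀
          ring₃ : ∀ M r → + 4 * r + + 1 * (r * (M - + 1)) ≡ r * (M + + 3)
          ring₃ = solve-∀
          ring₄ : ∀ M h r →
            - (M - + 1) * (h * (h * (h * + 1))) * (- (M - + 1) * (h * (h * (h * + 1))) * + 1)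
              * (+ 4 * r * (+ 4 * r * (+ 4 * r * + 1)))
            ≡ h * + 2 * (h * + 2 * (h * + 2 * (h * + 2 * (h * + 2 * (h * + 2 * + 1)))))
              * ((M - + 1) * ((M - + 1) * + 1) * (r * (r * (r * + 1))))
          ring₄ = solve-∀
          y-inverse : y * (- + 8 * s) ≈ + 1
          y-inverse = begin
            y * (- + 8 * s)                                  ≡⟨ ring₁ M half s ⟩
            powℤ (half * + 2) 3 * (s * (M - + 1))            ≈⟨ *-cong (powℤ-≈1 3 half-inverse) s-inverse ⟩
            + 1                                              ∎
          w-inverse : + 4 * r * (+ 1 - + 2 * y) ≈ + 1
          w-inverse = begin
            + 4 * r * (+ 1 - + 2 * y)                                ≡⟨ ring₂ M half r ⟩
            + 4 * r + powℤ (half * + 2) 3 * (r * (M - + 1))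
              ≈⟨ +-cong (≈-refl {+ 4 * r}) (*-congʳ (r * (M - + 1)) (powℤ-≈1 3 half-inverse)) ⟩
            + 4 * r + + 1 * (r * (M - + 1))                          ≡⟨ ring₃ M r ⟩
            r * (M + + 3)                                            ≈⟨ r-inverse ⟩
            + 1                                                      ∎

        -- At x = -1/(8(m-1)), 1-2x = (4m-3)/(4(m-1)), and the factor 4³ again cancels 8².
        QSum-cSum₁ : ∀ g r → g * - + 8 ≈ + 1 → r * (+ 4 * M - + 3) ≈ + 1 →
          QSum (g * n) ≈ cSum ((M - + 1) * powℤ r 3)
        QSum-cSum₁ g r g-inverse r-inverse = begin
          QSum (g * n)
            ≈⟨ QSum-franelSum g g-inverse ⟩
          franelSum (g * s)
            ≈⟨ franelSum-cSum (g * s) w w-inverse ⟩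
          cSum (powℤ (g * s) 2 * powℤ w 3)
            ≈⟨ cSum-cong (begin
                 powℤ (g * s) 2 * powℤ w 3
                   ≡⟨ ring₃ M g s r ⟩
                 powℤ (g * - + 8) 2 * powℤ (s * (M - + 1)) 2 * ((M - + 1) * powℤ r 3)
                   ≈⟨ *-congʳ _ (*-cong (powℤ-≈1 2 g-inverse) (powℤ-≈1 2 s-inverse)) ⟩
                 + 1 * ((M - + 1) * powℤ r 3)
                   ≡⟨ ℤ.*-identityˡ _ ⟩
                 (M - + 1) * powℤ r 3 ∎) ⟩
          cSum ((M - + 1) * powℤ r 3) ∎
          where
          w = + 4 * (M - + 1) * r
          ring₁ : ∀ M g s r → + 4 * (M - + 1) * r * (+ 1 - + 2 * (g * s))
            ≡ + 4 * (M - + 1) * r + g * - + 8 * (s * (M - + 1)) * r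
          ring₁ = solve-∀
          ring₂ : ∀ M r → + 4 * (M - + 1) * r + + 1 * r ≡ r * (+ 4 * M - + 3)
          ring₂ = solve-∀
          ring₃ : ∀ M g s r →
            g * s * (g * s * + 1) * (+ 4 * (M - + 1) * r * (+ 4 * (M - + 1) * r * (+ 4 * (M - + 1) * r * + 1)))
            ≡ g * - + 8 * (g * - + 8 * + 1) * (s * (M - + 1) * (s * (M - + 1) * + 1))
              * ((M - + 1) * (r * (r * (r * + 1))))
          ring₃ = solve-∀
          w-inverse : w * (+ 1 - + 2 * (g * s)) ≈ + 1
          w-inverse = begin
            w * (+ 1 - + 2 * (g * s))                    ≡⟨ ring₁ M g s r ⟩
            w + g * - + 8 * (s * (M - + 1)) * r          ≈⟨ +-cong (≈-refl {w}) (*-congʳ r (*-cong g-inverse s-inverse)) ⟩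
            w + + 1 * r                                  ≡⟨ ring₂ M r ⟩
            r * (+ 4 * M - + 3)                          ≈⟨ r-inverse ⟩
            + 1                                          ∎

        -- Reflection sends -1/(8(m-1)) to m-1, where 1-2x = -(2m-3); this is the origin of the
        -- minus sign in the last modulus.
        QSum-cSum₂ : ∀ g r → g * - + 8 ≈ + 1 → r * (+ 2 * M - + 3) ≈ + 1 →
          QSum (g * n) ≈ cSum (powℤ (M - + 1) 2 * (+ 0 - powℤ r 3))
        QSum-cSum₂ g r g-inverse r-inverse = begin
          QSum (g * n)
            ≈⟨ QSum-franelSum g g-inverse ⟩
          franelSum (g * s)
            ≈⟨ franelSum-reflect (g * s) (M - + 1) y-inverse ⟩
          franelSum (M - + 1)
            ≈⟨ franelSum-cSum (M - + 1) (- r) (≈-trans (≈-reflexive (ring₂ M r)) r-inverse) ⟩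
          cSum (powℤ (M - + 1) 2 * powℤ (- r) 3)
            ≡⟨ cong (λ z → cSum (powℤ (M - + 1) 2 * z)) (ring₃ r) ⟩
          cSum (powℤ (M - + 1) 2 * (+ 0 - powℤ r 3)) ∎
          where
          ring₁ : ∀ M g s → (M - + 1) * (- + 8 * (g * s)) ≡ g * - + 8 * (s * (M - + 1))
          ring₁ = solve-∀
          ring₂ : ∀ M r → - r * (+ 1 - + 2 * (M - + 1)) ≡ r * (+ 2 * M - + 3)
          ring₂ = solve-∀
          ring₃ : ∀ r → - r * (- r * (- r * + 1)) ≡ + 0 - r * (r * (r * + 1))
          ring₃ = solve-∀
          y-inverse : (M - + 1) * (- + 8 * (g * s)) ≈ + 1
          y-inverse = ≈-trans (≈-reflexive (ring₁ M g s)) (*-cong g-inverse s-inverse)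

-- Reduction of p-integral rationals to integers

module LocalIntegers where
  open import Data.Integer using (ℤ; _+_; _-_; _*_; ∣_∣)
  open import Data.Rational using (mkℚ; toℚᵘ; ↥_; ↧_; ↧ₙ_)
  open import Data.Rational.Unnormalised using (mkℚᵘ; *≡*)
  open FranelNumbers
  open PrimeFields
  open +-*-Solver using (solve; _:=_; _:+_; _:*_; :-_)

  toℚᵘ-ℤ→ℚ : ∀ z → toℚᵘ (ℤ→ℚ z) ℚᵘ.≃ mkℚᵘ z 0
  toℚᵘ-ℤ→ℚ z = ℚ.toℚᵘ-fromℚᵘ (mkℚᵘ z 0)

  ℤ→ℚ-+ : ∀ a b → ℤ→ℚ (a + b) ≡ ℤ→ℚ a ℚ.+ ℤ→ℚ b
  ℤ→ℚ-+ a b = ℚ.toℚᵘ-injective (ℚᵘ.≃-trans (toℚᵘ-ℤ→ℚ (a + b)) (ℚᵘ.≃-trans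
    (*≡* (cong (_* + 1) (cong₂ _+_ (sym (ℤ.*-identityʳ a)) (sym (ℤ.*-identityʳ b)))))
    (ℚᵘ.≃-sym (ℚᵘ.≃-trans (ℚ.toℚᵘ-homo-+ (ℤ→ℚ a) (ℤ→ℚ b)) (ℚᵘ.+-cong (toℚᵘ-ℤ→ℚ a) (toℚᵘ-ℤ→ℚ b))))))

  ℤ→ℚ-* : ∀ a b → ℤ→ℚ (a * b) ≡ ℤ→ℚ a ℚ.* ℤ→ℚ b
  ℤ→ℚ-* a b = ℚ.toℚᵘ-injective (ℚᵘ.≃-trans (toℚᵘ-ℤ→ℚ (a * b))
    (ℚᵘ.≃-sym (ℚᵘ.≃-trans (ℚ.toℚᵘ-homo-* (ℤ→ℚ a) (ℤ→ℚ b)) (ℚᵘ.*-cong (toℚᵘ-ℤ→ℚ a) (toℚᵘ-ℤ→ℚ b)))))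

  ℤ→ℚ-neg : ∀ a → ℤ→ℚ (- a) ≡ ℚ.- ℤ→ℚ a
  ℤ→ℚ-neg a = ℚ.toℚᵘ-injective (ℚᵘ.≃-trans (toℚᵘ-ℤ→ℚ (- a))
    (ℚᵘ.≃-sym (ℚᵘ.≃-trans (ℚ.toℚᵘ-homo‿- (ℤ→ℚ a)) (ℚᵘ.-‿cong (toℚᵘ-ℤ→ℚ a)))))

  fraction : ∀ q n d → q ℚ.* ℤ→ℚ d ≡ ℤ→ℚ n → ↥ q * d ≡ n * ↧ q
  fraction q@(mkℚ a b-1 _) n d eq = cross (ℚᵘ.≃-trans
    (ℚᵘ.≃-sym (ℚᵘ.≃-trans (ℚ.toℚᵘ-homo-* q (ℤ→ℚ d)) (ℚᵘ.*-congˡ {toℚᵘ q} (toℚᵘ-ℤ→ℚ d))))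
    (ℚᵘ.≃-trans (ℚ.toℚᵘ-cong eq) (toℚᵘ-ℤ→ℚ n)))
    where
    cross : (mkℚᵘ a b-1 ℚᵘ.* mkℚᵘ d 0) ℚᵘ.≃ mkℚᵘ n 0 → a * d ≡ n * + suc b-1
    cross (*≡* e) = trans (sym (ℤ.*-identityʳ (a * d)))
      (trans e (cong (n *_) (cong +_ (ℕ.*-identityʳ (suc b-1)))))

  ↥↧-fraction : ∀ q → q ℚ.* ℤ→ℚ (↧ q) ≡ ℤ→ℚ (↥ q)
  ↥↧-fraction q@(mkℚ a b-1 _) = ℚ.toℚᵘ-injective (ℚᵘ.≃-trans
    (ℚᵘ.≃-trans (ℚ.toℚᵘ-homo-* q (ℤ→ℚ (↧ q))) (ℚᵘ.*-congˡ {toℚᵘ q} (toℚᵘ-ℤ→ℚ (↧ q))))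
    (ℚᵘ.≃-trans (*≡* (trans (ℤ.*-identityʳ (a * + suc b-1)) (cong (a *_) (cong +_ (sym (ℕ.*-identityʳ (suc b-1)))))))
      (ℚᵘ.≃-sym (toℚᵘ-ℤ→ℚ a))))

  ℤ→ℚ-injective-0 : ∀ z → ℤ→ℚ z ≡ 0ℚ → z ≡ + 0
  ℤ→ℚ-injective-0 z eq = cross (ℚᵘ.≃-trans (ℚᵘ.≃-sym (toℚᵘ-ℤ→ℚ z)) (ℚ.toℚᵘ-cong eq))
    where
    cross : mkℚᵘ z 0 ℚᵘ.≃ mkℚᵘ (+ 0) 0 → z ≡ + 0
    cross (*≡* e) = trans (sym (ℤ.*-identityʳ z)) e

  inv-* : ∀ q → q ≢ 0ℚ → inv q ℚ.* q ≡ 1ℚ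
  inv-* q q≢0 with q ℚ.≟ 0ℚ
  ... | yes q≡0 = ⊥-elim (q≢0 q≡0)
  ... | no  q≢0 = ℚ.*-inverseˡ q {{ℚ.≢-nonZero q≢0}}

  module Reduction (p : ℕ) (p-prime : Prime p) where
    open PrimeModulus p p-prime

    -- q ↦ z: the rational q is p-integral and congruent to z; num/den need not be in lowest terms.
    infix 4 _↦_
    record _↦_ (q : ℚ) (z : ℤ) : Set where
      constructor reduce
      field
        num den  : ℤ
        q*den    : q ℚ.* ℤ→ℚ den ≡ ℤ→ℚ num
        den≉0    : ¬ (den ≈ + 0)
        num≈     : num ≈ z * den

    1≉0 : ¬ (+ 1 ≈ + 0)
    1≉0 e = ℕ.<⇒≱ (ℕ.nonTrivial⇒n>1 p {{prime⇒nonTrivial p-prime}}) (ℕ.∣⇒≤ (≈0-∣ e))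

    *-≉0 : ∀ {a b} → ¬ (a ≈ + 0) → ¬ (b ≈ + 0) → ¬ (a * b ≈ + 0)
    *-≉0 {a} {b} a≉0 b≉0 e = b≉0 (*-≈0⇒≈0 a b a≉0 e)

    ↦-ℤ : ∀ z → ℤ→ℚ z ↦ z
    ↦-ℤ z = reduce z (+ 1) (ℚ.*-identityʳ (ℤ→ℚ z)) 1≉0 (≈-reflexive (sym (ℤ.*-identityʳ z)))

    ↦-resp : ∀ {q a b} → a ≡ b → q ↦ a → q ↦ b
    ↦-resp refl q↦a = q↦a

    ↦-+ : ∀ {x y a b} → x ↦ a → y ↦ b → (x ℚ.+ y) ↦ (a + b)
    ↦-+ {x} {y} {a} {b} (reduce n d xd d≉0 n≈) (reduce m e ye e≉0 m≈) = reduce (n * e + m * d) (d * e)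
      (trans (cong ((x ℚ.+ y) ℚ.*_) (ℤ→ℚ-* d e))
        (trans (solve 4 (λ x y d e → (x :+ y) :* (d :* e) := (x :* d) :* e :+ (y :* e) :* d) refl x y (ℤ→ℚ d) (ℤ→ℚ e))
          (trans (cong₂ (λ u v → u ℚ.* ℤ→ℚ e ℚ.+ v ℚ.* ℤ→ℚ d) xd ye)
            (sym (trans (ℤ→ℚ-+ (n * e) (m * d)) (cong₂ ℚ._+_ (ℤ→ℚ-* n e) (ℤ→ℚ-* m d)))))))
      (*-≉0 d≉0 e≉0)
      (≈-trans (+-cong (*-congʳ e n≈) (*-congʳ d m≈)) (≈-reflexive (ring a b d e)))
      where
      ring : ∀ a b d e → a * d * e + b * e * d ≡ (a + b) * (d * e)
      ring = solve-∀

    ↦-* : ∀ {x y a b} → x ↦ a → y ↦ b → (x ℚ.* y) ↦ (a * b)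
    ↦-* {x} {y} {a} {b} (reduce n d xd d≉0 n≈) (reduce m e ye e≉0 m≈) = reduce (n * m) (d * e)
      (trans (cong ((x ℚ.* y) ℚ.*_) (ℤ→ℚ-* d e))
        (trans (solve 4 (λ x y d e → (x :* y) :* (d :* e) := (x :* d) :* (y :* e)) refl x y (ℤ→ℚ d) (ℤ→ℚ e))
          (trans (cong₂ ℚ._*_ xd ye) (sym (ℤ→ℚ-* n m)))))
      (*-≉0 d≉0 e≉0)
      (≈-trans (*-cong n≈ m≈) (≈-reflexive (ring a b d e)))
      where
      ring : ∀ a b d e → a * d * (b * e) ≡ a * b * (d * e)
      ring = solve-∀

    ↦-neg : ∀ {x a} → x ↦ a → (ℚ.- x) ↦ (- a)
    ↦-neg {x} {a} (reduce n d xd d≉0 n≈) = reduce (- n) d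
      (trans (sym (ℚ.neg-distribˡ-* x (ℤ→ℚ d))) (trans (cong ℚ.-_ xd) (sym (ℤ→ℚ-neg n))))
      d≉0
      (≈-trans (-‿cong n≈) (≈-reflexive (ℤ.neg-distribˡ-* a d)))

    ↦-- : ∀ {x y a b} → x ↦ a → y ↦ b → (x ℚ.- y) ↦ (a - b)
    ↦-- x↦a y↦b = ↦-+ x↦a (↦-neg y↦b)

    ↦-pow : ∀ {x a} k → x ↦ a → powℚ x k ↦ powℤ a k
    ↦-pow zero    x↦a = ↦-ℤ (+ 1)
    ↦-pow (suc k) x↦a = ↦-* x↦a (↦-pow k x↦a)

    ↦-sum : ∀ n {f : ℕ → ℚ} {g : ℕ → ℤ} → (∀ k → f k ↦ g k) → sumℚ n f ↦ sumℤ n g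
    ↦-sum zero    f↦g = ↦-ℤ (+ 0)
    ↦-sum (suc n) f↦g = ↦-+ (↦-sum n f↦g) (f↦g n)

    -- Numerator and denominator are exchanged. The numerator is a unit, for otherwise the
    -- denominator, congruent to w times it, would vanish. Hence x ≠ 0 and the default value of
    -- `inv` is never met.
    ↦-inv : ∀ {x a} w → w * a ≈ + 1 → x ↦ a → inv x ↦ w
    ↦-inv {x} {a} w wa≈1 (reduce n d xd d≉0 n≈) = reduce d n
      (trans (cong (inv x ℚ.*_) (sym xd))
        (trans (sym (ℚ.*-assoc (inv x) x (ℤ→ℚ d)))
          (trans (cong (ℚ._* ℤ→ℚ d) (inv-* x x≢0)) (ℚ.*-identityˡ (ℤ→ℚ d)))))
      n≉0
      (≈-sym wn≈d)
      where
      wn≈d : w * n ≈ d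
      wn≈d = ≈-trans (*-congˡ w n≈) (≈-trans (≈-reflexive (sym (ℤ.*-assoc w a d)))
        (≈-trans (*-congʳ d wa≈1) (≈-reflexive (ℤ.*-identityˡ d))))
      n≉0 : ¬ (n ≈ + 0)
      n≉0 n≈0 = d≉0 (≈-trans (≈-sym wn≈d) (*-≈0ʳ w n≈0))
      x≢0 : x ≢ 0ℚ
      x≢0 x≡0 = n≉0 (≈-reflexive (ℤ→ℚ-injective-0 n
        (trans (sym xd) (trans (cong (ℚ._* ℤ→ℚ d) x≡0) (ℚ.*-zeroˡ (ℤ→ℚ d))))))

    ↦-÷ : ∀ {x y a b} w → w * b ≈ + 1 → x ↦ a → y ↦ b → (x ÷' y) ↦ (a * w)
    ↦-÷ w wb≈1 x↦a y↦b = ↦-* x↦a (↦-inv w wb≈1 y↦b)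

    ↦-÷-pow : ∀ {x y a b} w k → w * b ≈ + 1 → x ↦ a → y ↦ b → (x ÷' powℚ y k) ↦ (a * powℤ w k)
    ↦-÷-pow {b = b} w k wb≈1 x↦a y↦b = ↦-÷ (powℤ w k)
      (≈-trans (≈-reflexive (sym (powℤ-distrib-* w b k))) (powℤ-≈1 k wb≈1)) x↦a (↦-pow k y↦b)

    residue : ∀ {q} → InZp p q → q ↦ (↥ q * inverse (↧ q))
    residue {q} q∈Zp = reduce (↥ q) (↧ q) (↥↧-fraction q) ↧q≉0
      (≈-sym (≈-trans (≈-reflexive (ℤ.*-assoc (↥ q) (inverse (↧ q)) (↧ q)))
        (≈-trans (*-congˡ (↥ q) (inverse-* (↧ q) ↧q≉0)) (≈-reflexive (ℤ.*-identityʳ (↥ q))))))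
      where
      ↧q≉0 : ¬ (↧ q ≈ + 0)
      ↧q≉0 e = q∈Zp (≈0-∣ e)

    -- If p divided the reduced denominator, cross multiplication with the unit d would make it
    -- divide the reduced numerator too, against coprimality.
    fraction-InZp : ∀ q n d → q ℚ.* ℤ→ℚ d ≡ ℤ→ℚ n → ¬ (d ≈ + 0) → InZp p q
    fraction-InZp q n d qd≡n d≉0 p∣↧q = contradict q p∣↧q p∣↥q
      where
      p∣↥q : p ℕ.∣ ∣ ↥ q ∣
      p∣↥q = ≈0-∣ (*-≈0⇒≈0 d (↥ q) d≉0
        (≈-trans (≈-reflexive (trans (ℤ.*-comm d (↥ q)) (fraction q n d qd≡n)))
                 (*-≈0ʳ n (∣-≈0 {↧ q} p∣↧q))))
      contradict : ∀ q → p ℕ.∣ ↧ₙ q → p ℕ.∣ ∣ ↥ q ∣ → _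
      contradict (mkℚ a b-1 coprime) p∣b p∣a =
        ⊥-elim-irr (¬prime[1] (subst Prime (coprime (p∣a , p∣b)) p-prime))

    -- The witness is (x-y)/p. Its representation keeps the denominator d, a unit, and has numerator
    -- k, where n = k·p.
    CongZp-0 : ∀ x y → (x ℚ.- y) ↦ + 0 → CongZp p x y
    CongZp-0 x y (reduce n d qd d≉0 (mod (divides k n-0≡kp))) = z , fraction-InZp z k d zd≡k d≉0 , sym Pz≡x-y
      where
      P i z : ℚ
      P = ℕ→ℚ p
      i = inv P
      z = i ℚ.* (x ℚ.- y)
      ring₁ : ∀ P i q → P ℚ.* (i ℚ.* q) ≡ (i ℚ.* P) ℚ.* q
      ring₁ = solve 3 (λ P i q → P :* (i :* q) := (i :* P) :* q) refl
      ring₂ : ∀ P i k → i ℚ.* (k ℚ.* P) ≡ (i ℚ.* P) ℚ.* k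
      ring₂ = solve 3 (λ P i k → i :* (k :* P) := (i :* P) :* k) refl
      iP≡1 : i ℚ.* P ≡ 1ℚ
      iP≡1 = inv-* P λ e → ℕ.<⇒≢ 0<p (sym (ℤ.+-injective (ℤ→ℚ-injective-0 (+ p) e)))
      Pz≡x-y : P ℚ.* z ≡ x ℚ.- y
      Pz≡x-y = trans (ring₁ P i (x ℚ.- y))
        (trans (cong (ℚ._* (x ℚ.- y)) iP≡1) (ℚ.*-identityˡ (x ℚ.- y)))
      n≡kp : n ≡ k * + p
      n≡kp = trans (sym (ℤ.+-identityʳ n)) n-0≡kp
      zd≡k : z ℚ.* ℤ→ℚ d ≡ ℤ→ℚ k
      zd≡k = trans (ℚ.*-assoc i (x ℚ.- y) (ℤ→ℚ d))
        (trans (cong (i ℚ.*_) (trans qd (trans (cong ℤ→ℚ n≡kp) (ℤ→ℚ-* k (+ p)))))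
          (trans (ring₂ P i (ℤ→ℚ k))
            (trans (cong (ℚ._* ℤ→ℚ k) iP≡1) (ℚ.*-identityˡ (ℤ→ℚ k)))))

    ↦-≈ : ∀ {x a b} → a ≈ b → x ↦ a → x ↦ b
    ↦-≈ a≈b (reduce n d xd d≉0 n≈) = reduce n d xd d≉0 (≈-trans n≈ (*-congʳ d a≈b))

    ↦-CongZp : ∀ {x y a b} → x ↦ a → y ↦ b → a ≈ b → CongZp p x y
    ↦-CongZp {x} {y} {a} {b} x↦a y↦b a≈b = CongZp-0 x y
      (↦-≈ (≈-trans (+-cong a≈b (≈-refl { - b})) (≈-reflexive (ℤ.+-inverseʳ b))) (↦-- x↦a y↦b))

    S23↦cSum : ∀ {t a} w → w * a ≈ + 1 → t ↦ a → S23 p t ↦ cSum w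
    S23↦cSum w wa≈1 t↦a = ↦-sum p λ k → ↦-÷-pow w k wa≈1 (↦-resp (c23≡c k) (↦-ℤ (+ (((2 ℕ.* k) C k) ℕ.* ((3 ℕ.* k) C k))))) t↦a
      where
      c23≡c : ∀ k → + (((2 ℕ.* k) C k) ℕ.* ((3 ℕ.* k) C k)) ≡ c k
      c23≡c k = trans (ℤ.pos-* ((2 ℕ.* k) C k) ((3 ℕ.* k) C k)) (cong₂ _*_ (binom-C (2 ℕ.* k) k) (binom-C (3 ℕ.* k) k))

  -- The congruences for a p-integral m

  module Congruences (p : ℕ) (p-prime : Prime p) (p≢2 : p ≢ 2) (m : ℚ) (m∈Zp : InZp p m)
           (m≢0 : ¬ CongZp p m 0ℚ) (m≢1 : ¬ CongZp p m 1ℚ) where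
    open PrimeModulus p p-prime
    open OddModulus p≢2
    open Reduction p p-prime

    private
    -- Representatives of m, 1/m, 1/(m−1) and −1/8.
      M n s g : ℤ
      M = ↥ m * inverse (↧ m)
      n = inverse M
      s = inverse (M - + 1)
      g = - powℤ half 3

      m↦M : m ↦ M
      m↦M = residue m∈Zp

      ≉-const : ∀ z → ¬ CongZp p m (ℤ→ℚ z) → ¬ (M - z ≈ + 0)
      ≉-const z m≢z e = m≢z (↦-CongZp m↦M (↦-ℤ z) (≈-difference e))

      n-inverse : n * M ≈ + 1
      n-inverse = inverse-* M λ M≈0 → m≢0 (↦-CongZp m↦M (↦-ℤ (+ 0)) M≈0)

      s-inverse : s * (M - + 1) ≈ + 1
      s-inverse = inverse-* (M - + 1) (≉-const (+ 1) m≢1)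

      g-inverse : g * - + 8 ≈ + 1
      g-inverse = ≈-trans (≈-reflexive (ring half)) (powℤ-≈1 3 half-inverse)
        where
        ring : ∀ h → - (h * (h * (h * + 1))) * - + 8 ≡ h * + 2 * (h * + 2 * (h * + 2 * + 1))
        ring = solve-∀

      2≉0 : ¬ (+ 2 ≈ + 0)
      2≉0 e = 1≉0 (≈-trans (≈-sym half-inverse) (*-≈0ʳ half e))

      a↦aSum : sumℚ p (λ k → ℕ→ℚ (aSeq k) ÷' powℚ m k) ↦ aSum n
      a↦aSum = ↦-sum p λ k → ↦-÷-pow n k n-inverse (↦-ℤ (+ aSeq k)) m↦M

      Q↦QSum : sumℚ p (λ k → ℤ→ℚ (QSeq k) ÷' powℚ (ℤ→ℚ (- + 8) ℚ.* m) k) ↦ QSum (g * n)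
      Q↦QSum = ↦-sum p λ k → ↦-÷-pow (g * n) k
        (≈-trans (≈-reflexive (ring g n M)) (*-cong g-inverse n-inverse))
        (↦-ℤ (QSeq k)) (↦-* (↦-ℤ (- + 8)) m↦M)
        where
        ring : ∀ g n M → g * n * (- + 8 * M) ≡ g * - + 8 * (n * M)
        ring = solve-∀

      m-1↦ : (m ℚ.- 1ℚ) ↦ (M - + 1)
      m-1↦ = ↦-- m↦M (↦-ℤ (+ 1))

      ring-1-3 : ∀ M s r y → (M - + 1) * (r * (r * (r * + 1))) * (y * (y * (y * + 1)) * s)
        ≡ s * (M - + 1) * (r * y * (r * y * (r * y * + 1)))
      ring-1-3 = solve-∀

      ring-2-3 : ∀ M s r y → (M - + 1) * ((M - + 1) * + 1) * (r * (r * (r * + 1))) * (y * (y * (y * + 1)) * (s * (s * + 1)))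
        ≡ s * (M - + 1) * (s * (M - + 1) * + 1) * (r * y * (r * y * (r * y * + 1)))
      ring-2-3 = solve-∀

      ring-neg : ∀ M s r y → (M - + 1) * ((M - + 1) * + 1) * (+ 0 - r * (r * (r * + 1))) * ((+ 0 - y * (y * (y * + 1))) * (s * (s * + 1)))
        ≡ s * (M - + 1) * (s * (M - + 1) * + 1) * (r * y * (r * y * (r * y * + 1)))
      ring-neg = solve-∀

      S23↦₁ : ∀ {x y} r → r * y ≈ + 1 → x ↦ y →
        S23 p (powℚ x 3 ÷' (m ℚ.- 1ℚ)) ↦ cSum ((M - + 1) * powℤ r 3)
      S23↦₁ {y = y} r ry≈1 x↦y = S23↦cSum _
        (≈-trans (≈-reflexive (ring-1-3 M s r y)) (*-cong s-inverse (powℤ-≈1 3 ry≈1)))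
        (↦-÷ s s-inverse (↦-pow 3 x↦y) m-1↦)

      S23↦₂ : ∀ {x y} r → r * y ≈ + 1 → x ↦ y →
        S23 p (powℚ x 3 ÷' powℚ (m ℚ.- 1ℚ) 2) ↦ cSum (powℤ (M - + 1) 2 * powℤ r 3)
      S23↦₂ {y = y} r ry≈1 x↦y = S23↦cSum _
        (≈-trans (≈-reflexive (ring-2-3 M s r y)) (*-cong (powℤ-≈1 2 s-inverse) (powℤ-≈1 3 ry≈1)))
        (↦-÷-pow s 2 s-inverse (↦-pow 3 x↦y) m-1↦)

      S23↦₃ : ∀ {x y} r → r * y ≈ + 1 → x ↦ y →
        S23 p ((0ℚ ℚ.- powℚ x 3) ÷' powℚ (m ℚ.- 1ℚ) 2) ↦ cSum (powℤ (M - + 1) 2 * (+ 0 - powℤ r 3))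
      S23↦₃ {y = y} r ry≈1 x↦y = S23↦cSum _
        (≈-trans (≈-reflexive (ring-neg M s r y)) (*-cong (powℤ-≈1 2 s-inverse) (powℤ-≈1 3 ry≈1)))
        (↦-÷-pow s 2 s-inverse (↦-- (↦-ℤ (+ 0)) (↦-pow 3 x↦y)) m-1↦)

    a-congruence₁ : ¬ CongZp p m (ℤ→ℚ (+ 3)) →
      CongZp p (sumℚ p (λ k → ℕ→ℚ (aSeq k) ÷' powℚ m k))
               (S23 p (powℚ (m ℚ.- ℤ→ℚ (+ 3)) 3 ÷' (m ℚ.- 1ℚ)))
    a-congruence₁ m≢3 = ↦-CongZp a↦aSum (S23↦₁ r r-inverse (↦-- m↦M (↦-ℤ (+ 3))))
      (aSum-cSum₁ M n s n-inverse s-inverse r r-inverse)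
      where
      r = inverse (M - + 3)
      r-inverse = inverse-* (M - + 3) (≉-const (+ 3) m≢3)

    a-congruence₂ : ¬ CongZp p m (ℤ→ℚ (- + 3)) →
      CongZp p (sumℚ p (λ k → ℕ→ℚ (aSeq k) ÷' powℚ m k))
               (S23 p (powℚ (m ℚ.+ ℤ→ℚ (+ 3)) 3 ÷' powℚ (m ℚ.- 1ℚ) 2))
    a-congruence₂ m≢-3 = ↦-CongZp a↦aSum (S23↦₂ r r-inverse (↦-+ m↦M (↦-ℤ (+ 3))))
      (aSum-cSum₂ M n s n-inverse s-inverse r r-inverse)
      where
      r = inverse (M + + 3)
      r-inverse = inverse-* (M + + 3) (≉-const (- + 3) m≢-3)

    Q-congruence₁ : ¬ CongZp p m (+ 3 ℚ./ 4) →
      CongZp p (sumℚ p (λ k → ℤ→ℚ (QSeq k) ÷' powℚ (ℤ→ℚ (- + 8) ℚ.* m) k))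
               (S23 p (powℚ (ℤ→ℚ (+ 4) ℚ.* m ℚ.- ℤ→ℚ (+ 3)) 3 ÷' (m ℚ.- 1ℚ)))
    Q-congruence₁ m≢3/4 = ↦-CongZp Q↦QSum (S23↦₁ r r-inverse (↦-- (↦-* (↦-ℤ (+ 4)) m↦M) (↦-ℤ (+ 3))))
      (QSum-cSum₁ M n s n-inverse s-inverse g r g-inverse r-inverse)
      where
      r = inverse (+ 4 * M - + 3)
      r-inverse = inverse-* (+ 4 * M - + 3) λ e → m≢3/4 (↦-CongZp {m} {+ 3 ℚ./ 4} m↦M
        -- If 4M ≡ 3, the fraction 3/4 itself reduces to `M`, since 4 is a unit for odd p; m would
        -- then be congruent to 3/4.
        (reduce (+ 3) (+ 4) refl (*-≉0 {+ 2} {+ 2} 2≉0 2≉0)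
          (≈-trans (≈-sym (≈-difference e)) (≈-reflexive (ℤ.*-comm (+ 4) M)))) (≈-refl {M}))

    Q-congruence₂ : ¬ CongZp p m (+ 3 ℚ./ 2) →
      CongZp p (sumℚ p (λ k → ℤ→ℚ (QSeq k) ÷' powℚ (ℤ→ℚ (- + 8) ℚ.* m) k))
               (S23 p ((0ℚ ℚ.- powℚ (ℤ→ℚ (+ 2) ℚ.* m ℚ.- ℤ→ℚ (+ 3)) 3) ÷' powℚ (m ℚ.- 1ℚ) 2))
    Q-congruence₂ m≢3/2 = ↦-CongZp Q↦QSum (S23↦₃ r r-inverse (↦-- (↦-* (↦-ℤ (+ 2)) m↦M) (↦-ℤ (+ 3))))
      (QSum-cSum₂ M n s n-inverse s-inverse g r g-inverse r-inverse)
      where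
      r = inverse (+ 2 * M - + 3)
      r-inverse = inverse-* (+ 2 * M - + 3) λ e → m≢3/2 (↦-CongZp {m} {+ 3 ℚ./ 2} m↦M
        (reduce (+ 3) (+ 2) refl 2≉0
          (≈-trans (≈-sym (≈-difference e)) (≈-reflexive (ℤ.*-comm (+ 2) M)))) (≈-refl {M}))

open import Data.Rational using (_+_; _-_; _*_; _/_)

theorem5p1 : (p : ℕ) → Prime p → p ≢ 2 → (m : ℚ) → InZp p m →
  ¬ CongZp p m 0ℚ → ¬ CongZp p m 1ℚ →
  ((¬ CongZp p m (+ 3 / 1) →
      CongZp p (sumℚ p (λ k → ℕ→ℚ (aSeq k) ÷' powℚ m k))
               (S23 p (powℚ (m - + 3 / 1) 3 ÷' (m - 1ℚ))))
  × (¬ CongZp p m (- (+ 3) / 1) →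
      CongZp p (sumℚ p (λ k → ℕ→ℚ (aSeq k) ÷' powℚ m k))
               (S23 p (powℚ (m + + 3 / 1) 3 ÷' powℚ (m - 1ℚ) 2)))
  × (¬ CongZp p m (+ 3 / 4) →
      CongZp p (sumℚ p (λ k → ℤ→ℚ (QSeq k) ÷' powℚ ((- (+ 8) / 1) * m) k))
               (S23 p (powℚ ((+ 4 / 1) * m - + 3 / 1) 3 ÷' (m - 1ℚ))))
  × (¬ CongZp p m (+ 3 / 2) →
      CongZp p (sumℚ p (λ k → ℤ→ℚ (QSeq k) ÷' powℚ ((- (+ 8) / 1) * m) k))
               (S23 p ((0ℚ - powℚ ((+ 2 / 1) * m - + 3 / 1) 3) ÷' powℚ (m - 1ℚ) 2))))
theorem5p1 p p-prime p≢2 m m∈Zp m≢0 m≢1 = a-congruence₁ , a-congruence₂ , Q-congruence₁ , Q-congruence₂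
  where open LocalIntegers.Congruences p p-prime p≢2 m m∈Zp m≢0 m≢1
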